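{- Let $n$ be a non-negative integer. Consider the overpartitions of $n$ such that: (i) if $1$ occurs as a part, then the first instance of $1$ is overlined; and (ii) for every positive integer $k$, if $k+1$ occurs as a part and $\overline{k}$ (the overlined $k$) occurs as a part, then the overlined part $\overline{k+1}$ occurs (that is, $(\overline{k+1},k+1,\dots,k+1,\overline{k})$ is allowed, but no pattern $(k+1,\overline{k})$ appears if the overlined $k+1$ is missing). The number of such overpartitions of $n$ is equal to the number of partitions of $n$ into parts of two colors, red and green, where the green parts are always congruent to $2$ modulo $3$ (and the red parts are arbitrary positive integers).
   Context: A partition of $n$ is a finite non-increasing sequence of positive integers (parts) with sum $n$. An overpartition of $n$ is a partition of $n$ in which the first appearance of each part size may (or may not) be overlined. In the two-color partitions, each part carries a color, red or green; parts may repeat, and only the multiplicity of each colored integer matters (red $k$ and green $k$ are different parts of the same size $k$). -}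

module Defs where

open import Data.Nat using (ℕ; suc; _<_; _≥_)
open import Data.Nat.DivMod using (_%_)
open import Data.List using (List; map; sum; length)
open import Data.List.Membership.Propositional using (_∈_)
open import Data.List.Relation.Unary.All using (All)
open import Data.List.Relation.Unary.Linked using (Linked)
open import Data.List.Relation.Unary.Unique.Propositional using (Unique)
open import Data.Product using (_×_; _,_; proj₁; proj₂; ∃-syntax)
open import Function.Bundles using (_⇔_)
open import Relation.Binary.PropositionalEquality using (_≡_)

record IsPartition (n : ℕ) (xs : List ℕ) : Set where
  field
    positive      : All (0 <_) xs
    nonIncreasing : Linked _≥_ xs
    total         : sum xs ≡ n

data Mark : Set where
  plain overlined : Mark

-- An overlined part must be strictly smaller than the part preceding it (if
-- any), i.e. it is the first appearance of its size.
record IsOverpartition (n : ℕ) (xs : List (ℕ × Mark)) : Set where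
  field
    partition     : IsPartition n (map proj₁ xs)
    overlineFirst : Linked (λ p q → proj₂ q ≡ overlined → proj₁ q < proj₁ p) xs

Occurs : ℕ → List (ℕ × Mark) → Set
Occurs k xs = k ∈ map proj₁ xs

OccursOverlined : ℕ → List (ℕ × Mark) → Set
OccursOverlined k xs = (k , overlined) ∈ xs

record IsAdmissibleOverpartition (n : ℕ) (xs : List (ℕ × Mark)) : Set where
  field
    overpartition : IsOverpartition n xs
    one           : Occurs 1 xs → OccursOverlined 1 xs
    consecutive   : ∀ k → 0 < k → Occurs (suc k) xs → OccursOverlined k xs →
                    OccursOverlined (suc k) xs

data Colour : Set where
  red green : Colour

-- Only the multiplicities of the coloured integers matter, so each coloured
-- partition is represented by one canonical list: among parts of equal size,
-- the red ones come before the green ones.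
record IsTwoColourPartition (n : ℕ) (xs : List (ℕ × Colour)) : Set where
  field
    partition      : IsPartition n (map proj₁ xs)
    redBeforeGreen : Linked (λ p q → proj₁ p ≡ proj₁ q →
                                     proj₂ p ≡ green → proj₂ q ≡ green) xs

record IsTwoColourPartitionGreen2Mod3 (n : ℕ) (xs : List (ℕ × Colour)) : Set where
  field
    twoColour  : IsTwoColourPartition n xs
    green2Mod3 : All (λ p → proj₂ p ≡ green → proj₁ p % 3 ≡ 2) xs

-- Exactly N elements of A satisfy P: some duplicate-free list of length N
-- contains precisely those elements.
HasCardinality : {A : Set} → (A → Set) → ℕ → Set
HasCardinality {A} P N =
  ∃[ xs ] (Unique {A = A} xs × (∀ x → x ∈ xs ⇔ P x) × length xs ≡ N)

{-# OPTIONS --safe #-}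

-- Reading an admissible overpartition from its largest part, with a_k and b_k the generating
-- functions of those with parts at most k in which k is not, respectively is, overlined,
--   a_{k+1} = a_k / (1 - q^{k+1}) + b_k,   b_{k+1} = q^{k+1} (a_k + b_k) / (1 - q^{k+1}).
-- Hence T_{k+1} = (q ; q)_k (a_k + b_k) satisfies the recurrence
--   T_{n+2} = (1 + q^{n+1}) T_{n+1} - q^{2n+1} T_n,   T_0 = T_1 = 1,
-- of Ramanujan's continued fraction for (q² ; q³)_∞ / (q ; q³)_∞. Its solution is
--   T_n = Σ_j q^{3j² - j} (q ; q³)_j [n choose 3j]_q,
-- which tends to Σ_j q^{3j² - j} / ((q² ; q³)_j (q³ ; q³)_j) = 1 / (q² ; q³)_∞ by Cauchy's
-- identity. All computations take place in power series modulo q^M for a fixed M, so that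
-- the limits become equalities for large indices.

module Submission where

open import Algebra.Bundles using (CommutativeRing)
import Algebra.Properties.CommutativeSemiring.Exp as CommutativeSemiringExp
open import Algebra.Solver.Ring.AlmostCommutativeRing
  using (fromCommutativeRing; _-Raw-AlmostCommutative⟶_)
open import Data.Empty using (⊥; ⊥-elim)
open import Data.Integer as ℤ using (ℤ; 0ℤ; 1ℤ) renaming (+_ to pos)
import Data.Integer.Properties as ℤ
open import Data.Integer.Tactic.RingSolver using (solve-∀)
open import Data.List using (List; []; _∷_; _++_; map)
import Data.List.Properties as List
open import Data.List.Membership.Propositional using (_∈_)
open import Data.List.Membership.Propositional.Properties using (∈-map⁺; ∈-map⁻; ∈-++⁺ˡ; ∈-++⁺ʳ; ∈-++⁻)
open import Data.List.Relation.Unary.All as All using (All; []; _∷_)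
import Data.List.Relation.Unary.All.Properties as All
open import Data.List.Relation.Unary.AllPairs as AllPairs using (AllPairs; []; _∷_)
open import Data.List.Relation.Unary.Any using (here; there)
open import Data.List.Relation.Unary.Linked as Linked using (Linked)
import Data.List.Relation.Unary.Linked.Properties as Linked
import Data.List.Relation.Unary.Unique.Propositional.Properties as Unique
open import Data.Maybe using (Maybe; just; nothing)
open import Data.Nat as ℕ using (ℕ; zero; suc; z≤n; s≤s; s≤s⁻¹)
open import Data.Nat.DivMod using (_%_; [m+kn]%n≡m%n)
open import Data.Nat.ListAction using (sum)
import Data.Nat.Properties as ℕ
open import Data.Product using (_×_; _,_; proj₁; proj₂; ∃-syntax)
open import Data.Sum as Sum using (_⊎_; inj₁; inj₂; [_,_]′)
open import Function using (_∘_; id)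
open import Function.Bundles using (_⇔_; mk⇔; Equivalence)
open import Relation.Binary.PropositionalEquality as ≡ using (_≡_)
open import Relation.Nullary using (¬_; Dec; yes; no)
open import Defs

-- q-series in a ring where q is nilpotent

-- If `k` is overlined, a part `k+1` requires an overlined `k+1`. So `b_k` enters `a_{k+1}`
-- undivided (no part `k+1` occurs at all), whereas an overlined `k+1` may sit on top of anything,
-- which gives the factor `a_k + b_k` in `b_{k+1}`. With `q` nilpotent, powers of `q` cannot be
-- cancelled and no infinite sum is at hand. Gaussian binomials are therefore defined by Pascal's
-- rule, and their quotient rule keeps a power of the base as a factor. Sums over `j` stop at a
-- fixed `J`: each telescoping argument leaves one boundary term with the factor q^(3J² - J), which
-- is zero as soon as J ≥ M. Cauchy's identity is used with a finite `N`, where the sum equals 1 /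
-- (q² ; q³)_N. What remains is to compare two finite sums, one with binomials in base `q` and one
-- in base `q³`, whose terms have the same limits. Quotients by 1 - q^(k+1) are replaced throughout
-- by product equations.

module QSeries
  {c ℓ} (R : CommutativeRing c ℓ)
  (ℤ⟶R : CommutativeRing.rawRing ℤ.+-*-commutativeRing -Raw-AlmostCommutative⟶ fromCommutativeRing R)
  where

  open CommutativeRing R hiding (zero)
  open CommutativeSemiringExp commutativeSemiring
  open import Relation.Binary.Reasoning.Setoid setoid
  open _-Raw-AlmostCommutative⟶_ ℤ⟶R using (⟦_⟧)

  coeff≟ : ∀ i j → Maybe (⟦ i ⟧ ≈ ⟦ j ⟧)
  coeff≟ i j with i ℤ.≟ j
  ... | yes i≡j = just (reflexive (≡.cong ⟦_⟧ i≡j))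
  ... | no _    = nothing

  open import Algebra.Solver.Ring (CommutativeRing.rawRing ℤ.+-*-commutativeRing) (fromCommutativeRing R) ℤ⟶R coeff≟
    using (Polynomial; solve; _:=_; _:+_; _:*_; _:-_; :-_; _:^_)

  -- The numeral 1, as a power so that it evaluates to 1# and not to ⟦ ℤ.+ 1 ⟧.
  one : ∀ {n} → Polynomial n → Polynomial n
  one x = x :^ 0

  -- Equations that follow linearly from others are proved by letting the solver write the left
  -- side as the right side plus multiples of differences, which are then removed one by one.
  cancel-zero : ∀ {a b} r l → a ≈ b → r + l * (a - b) ≈ r
  cancel-zero {a} {b} r l a≈b = begin
    r + l * (a - b) ≈⟨ +-congˡ (*-congˡ (trans (+-congʳ a≈b) (-‿inverseʳ b))) ⟩
    r + l * 0#      ≈⟨ +-congˡ (zeroʳ l) ⟩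
    r + 0#          ≈⟨ +-identityʳ r ⟩
    r               ∎

  -- Gaussian binomial coefficients

  qbinom : Carrier → ℕ → ℕ → Carrier
  qbinom x n       zero    = 1#
  qbinom x zero    (suc m) = 0#
  qbinom x (suc n) (suc m) = qbinom x n m + x ^ suc m * qbinom x n (suc m)

  -- The rule (1 - x^(m+1)) [n choose m+1] = (1 - x^(n-m)) [n choose m], multiplied by `x ^ m`. This
  -- form needs no subtraction n - m and also covers n < m, where both binomials vanish. The factor
  -- `x ^ m` has to stay, since it cannot be cancelled later.
  qbinom-absorption : ∀ x n m →
    x ^ m * (1# - x * x ^ m) * qbinom x n (suc m) ≈ (x ^ m - x ^ n) * qbinom x n m
  qbinom-absorption x zero zero = begin
    1# * (1# - x * 1#) * 0#  ≈⟨ zeroʳ _ ⟩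
    0#                       ≈⟨ sym (-‿inverseʳ 1#) ⟩
    1# - 1#                  ≈⟨ sym (*-identityʳ _) ⟩
    (1# - 1#) * 1#           ∎
  qbinom-absorption x zero (suc m) = trans (zeroʳ _) (sym (zeroʳ _))
  qbinom-absorption x (suc n) zero = begin
    1# * (1# - x * 1#) * (1# + x * 1# * v)
      ≈⟨ solve 3 (λ x w v → one x :* (one x :- x :* one x) :* (one x :+ x :* one x :* v)
           := (one x :- x :* w) :* one x
              :+ x :* (one x :* (one x :- x :* one x) :* v :- (one x :- w) :* one x)) refl x (x ^ n) v ⟩
    (1# - x * x ^ n) * 1# + x * (1# * (1# - x * 1#) * v - (1# - x ^ n) * 1#)
      ≈⟨ cancel-zero _ x (qbinom-absorption x n zero) ⟩
    (1# - x * x ^ n) * 1# ∎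
    where v = qbinom x n 1
  qbinom-absorption x (suc n) (suc m) = begin
    (x * y) * (1# - x * (x * y)) * (v + (x * (x * y)) * t)
      ≈⟨ solve 6 (λ x y w u v t →
           (x :* y) :* (one x :- x :* (x :* y)) :* (v :+ (x :* (x :* y)) :* t)
           := ((x :* y :- x :* w) :* (u :+ x :* y :* v)
               :+ (x :* (x :* y)) :* ((x :* y) :* (one x :- x :* (x :* y)) :* t :- (x :* y :- w) :* v))
               :+ x :* (y :* (one x :- x :* y) :* v :- (y :- w) :* u)) refl x y w u v t ⟩
    ((x * y - x * w) * (u + x * y * v)
      + (x * (x * y)) * ((x * y) * (1# - x * (x * y)) * t - (x * y - w) * v))
      + x * (y * (1# - x * y) * v - (y - w) * u)
      ≈⟨ cancel-zero _ _ (qbinom-absorption x n m) ⟩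
    (x * y - x * w) * (u + x * y * v)
      + (x * (x * y)) * ((x * y) * (1# - x * (x * y)) * t - (x * y - w) * v)
      ≈⟨ cancel-zero _ _ (qbinom-absorption x n (suc m)) ⟩
    (x * y - x * w) * (u + x * y * v) ∎
    where
    y = x ^ m
    w = x ^ n
    u = qbinom x n m
    v = qbinom x n (suc m)
    t = qbinom x n (suc (suc m))

  module Truncated
    (q : Carrier) (M : ℕ) (q^M≈0 : q ^ M ≈ 0#)
    (inv : ℕ → Carrier) (inv-inverse : ∀ k → (1# - q ^ suc k) * inv k ≈ 1#)
    where

    ^-vanish : ∀ {x} n → x ^ M ≈ 0# → M ℕ.≤ n → x ^ n ≈ 0#
    ^-vanish {x} n x^M≈0 M≤n = begin
      x ^ n                  ≡⟨ ≡.cong (x ^_) (≡.sym (ℕ.m+[n∸m]≡n M≤n)) ⟩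
      x ^ (M ℕ.+ (n ℕ.∸ M))  ≈⟨ ^-homo-* x M (n ℕ.∸ M) ⟩
      x ^ M * x ^ (n ℕ.∸ M)  ≈⟨ *-congʳ x^M≈0 ⟩
      0# * x ^ (n ℕ.∸ M)     ≈⟨ zeroˡ _ ⟩
      0#                     ∎

    -- `H m` is 1 / (x ; x)_m, from which [n choose m] differs by a multiple of x^(n-m+1). The extra
    -- exponent `e` makes the induction on `n` work: the second term of Pascal's rule brings the
    -- factor x^(m+1), which is absorbed into `e` and more than pays for the smaller `n`. At n = 0
    -- the exponent has reached `M`.
    qbinom-limit : ∀ x → x ^ M ≈ 0# →
      (H : ℕ → Carrier) → H 0 ≈ 1# → (∀ m → (1# - x * x ^ m) * H (suc m) ≈ H m) →
      ∀ e n m → M ℕ.+ m ℕ.≤ e ℕ.+ suc n → x ^ e * qbinom x n m ≈ x ^ e * H m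
    qbinom-limit x x^M≈0 H H-zero H-suc = go
      where
      go : ∀ e n m → M ℕ.+ m ℕ.≤ e ℕ.+ suc n → x ^ e * qbinom x n m ≈ x ^ e * H m
      go e n zero p = *-congˡ (sym H-zero)
      go e zero (suc m) p = trans (zeroʳ _) (sym (trans (*-congʳ (^-vanish e x^M≈0 M≤e)) (zeroˡ _)))
        where
        M≤e : M ℕ.≤ e
        M≤e = ℕ.≤-trans (ℕ.m≤m+n M m)
                (s≤s⁻¹ (≡.subst₂ ℕ._≤_ (ℕ.+-suc M m) (≡.trans (ℕ.+-suc e 0) (≡.cong suc (ℕ.+-identityʳ e))) p))
      go e (suc n) (suc m) p = begin
        x ^ e * (qbinom x n m + x ^ suc m * qbinom x n (suc m))
          ≈⟨ distribˡ _ _ _ ⟩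
        x ^ e * qbinom x n m + x ^ e * (x ^ suc m * qbinom x n (suc m))
          ≈⟨ +-cong (go e n m p₁) (sym (*-assoc _ _ _)) ⟩
        x ^ e * H m + (x ^ e * x ^ suc m) * qbinom x n (suc m)
          ≈⟨ +-congˡ (*-congʳ (sym (^-homo-* x e (suc m)))) ⟩
        x ^ e * H m + x ^ (e ℕ.+ suc m) * qbinom x n (suc m)
          ≈⟨ +-congˡ (go (e ℕ.+ suc m) n (suc m) p₂) ⟩
        x ^ e * H m + x ^ (e ℕ.+ suc m) * H (suc m)
          ≈⟨ +-cong (*-congˡ (sym (H-suc m))) (*-congʳ (^-homo-* x e (suc m))) ⟩
        x ^ e * ((1# - x * x ^ m) * H (suc m)) + (x ^ e * x ^ suc m) * H (suc m)
          ≈⟨ solve 4 (λ e x y h → e :* ((one x :- x :* y) :* h) :+ (e :* (x :* y)) :* h := e :* h)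
               refl (x ^ e) x (x ^ m) (H (suc m)) ⟩
        x ^ e * H (suc m) ∎
        where
        p′ : suc (M ℕ.+ m) ℕ.≤ suc (e ℕ.+ suc n)
        p′ = ≡.subst₂ ℕ._≤_ (ℕ.+-suc M m) (ℕ.+-suc e (suc n)) p
        p₁ : M ℕ.+ m ℕ.≤ e ℕ.+ suc n
        p₁ = s≤s⁻¹ p′
        p₂ : M ℕ.+ suc m ℕ.≤ (e ℕ.+ suc m) ℕ.+ suc n
        p₂ = ℕ.≤-trans p (ℕ.≤-trans (ℕ.≤-reflexive (ℕ.+-suc e (suc n)))
               (ℕ.+-monoˡ-≤ (suc n) (ℕ.≤-trans (s≤s (ℕ.m≤m+n e m)) (ℕ.≤-reflexive (≡.sym (ℕ.+-suc e m))))))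

    Σ≤ : ℕ → (ℕ → Carrier) → Carrier
    Σ≤ zero    f = f 0
    Σ≤ (suc J) f = Σ≤ J f + f (suc J)

    Σ≤-cong : ∀ J {f g} → (∀ j → j ℕ.≤ J → f j ≈ g j) → Σ≤ J f ≈ Σ≤ J g
    Σ≤-cong zero    f≈g = f≈g 0 z≤n
    Σ≤-cong (suc J) f≈g = +-cong (Σ≤-cong J λ j j≤J → f≈g j (ℕ.m≤n⇒m≤1+n j≤J)) (f≈g (suc J) ℕ.≤-refl)

    -- In Pochhammer notation: d j = q ^ (3j² - j), a j = (q ; q³)ⱼ,
    -- g j = 1 / (q² ; q³)ⱼ, h m = 1 / (q ; q)ₘ and H j = 1 / (q³ ; q³)ⱼ.
    d a g h H : ℕ → Carrier
    d zero    = 1#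
    d (suc j) = d j * (q * q * (q ^ (j ℕ.* 3) * q ^ (j ℕ.* 3)))
    a zero    = 1#
    a (suc j) = a j * (1# - q * q ^ (j ℕ.* 3))
    g zero    = 1#
    g (suc j) = g j * inv (suc (j ℕ.* 3))
    h zero    = 1#
    h (suc m) = h m * inv m
    H zero    = 1#
    H (suc j) = H j * inv (suc (suc (j ℕ.* 3)))

    -- This is q^(3j² - 2j), the cofactor that exhibits `q ^ j` as a divisor of `d j`.
    d-factor : ℕ → Carrier
    d-factor zero    = 1#
    d-factor (suc j) = d-factor j * (q * (q ^ (j ℕ.* 3) * q ^ (j ℕ.* 3)))

    d≈q^* : ∀ j → d j ≈ q ^ j * d-factor j
    d≈q^* zero    = sym (*-identityʳ 1#)
    d≈q^* (suc j) = trans (*-congʳ (d≈q^* j))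
      (solve 4 (λ q x e y → (x :* e) :* (q :* q :* (y :* y)) := (q :* x) :* (e :* (q :* (y :* y))))
        refl q (q ^ j) (d-factor j) (q ^ (j ℕ.* 3)))

    d-vanish : ∀ j → M ℕ.≤ j → d j ≈ 0#
    d-vanish j M≤j = trans (d≈q^* j) (trans (*-congʳ (^-vanish j q^M≈0 M≤j)) (zeroˡ _))

    -- For J ≥ M, T J (suc k) / (q ; q)ₖ will be the generating function of the
    -- admissible overpartitions with parts at most k.
    T : ℕ → ℕ → Carrier
    T J n = Σ≤ J (λ j → d j * a j * qbinom q n (j ℕ.* 3))

    T-boundary : ℕ → ℕ → Carrier
    T-boundary J n = q * q ^ n * (d J * a J * ((q ^ (J ℕ.* 3) - q ^ n) * qbinom q n (J ℕ.* 3)))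

    -- A Zeilberger-type proof: T-boundary is the certificate that makes the sum over j telescope.
    T-step : ∀ J n →
      T J (suc (suc n)) + q ^ n * (q * q ^ n) * T J n + T-boundary J n ≈ (1# + q * q ^ n) * T J (suc n)
    T-step zero n = solve 2 (λ q w →
        let 1′ = one q in
        1′ :* 1′ :* 1′ :+ w :* (q :* w) :* (1′ :* 1′ :* 1′) :+ q :* w :* (1′ :* 1′ :* ((1′ :- w) :* 1′))
        := (1′ :+ q :* w) :* (1′ :* 1′ :* 1′)) refl q (q ^ n)
    T-step (suc J) n = begin
      (t₂ + C * p₂) + w * (q * w) * (t₀ + C * u₃) + q * w * (C * ((q * (q * (q * y)) - w) * u₃))
        ≈⟨ solve 9 (λ q b w t₀ t₁ t₂ C D p →
             (t₂ :+ p) :+ w :* (q :* w) :* (t₀ :+ C) :+ b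
             := (one q :+ q :* w) :* t₁
               :+ ((p :+ w :* (q :* w) :* C :+ b) :- D)
               :+ one q :* ((t₂ :+ w :* (q :* w) :* t₀ :+ D) :- (one q :+ q :* w) :* t₁))
             refl q (q * w * (C * ((q * (q * (q * y)) - w) * u₃))) w t₀ t₁ t₂ (C * u₃) (T-boundary J n) (C * p₂) ⟩
      (1# + q * w) * t₁ + E + 1# * ((t₂ + w * (q * w) * t₀ + T-boundary J n) - (1# + q * w) * t₁)
        ≈⟨ cancel-zero _ 1# (T-step J n) ⟩
      (1# + q * w) * t₁ + E
        ≈⟨ +-congˡ E≈ ⟩
      (1# + q * w) * t₁ + (1# + q * w) * (C * p₁)
        ≈⟨ sym (distribˡ _ _ _) ⟩
      (1# + q * w) * (t₁ + C * p₁) ∎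
      where
      m  = J ℕ.* 3
      y  = q ^ m
      w  = q ^ n
      t₀ = T J n
      t₁ = T J (suc n)
      t₂ = T J (suc (suc n))
      u₀ = qbinom q n m
      u₁ = qbinom q n (suc m)
      u₂ = qbinom q n (suc (suc m))
      u₃ = qbinom q n (suc (suc (suc m)))
      -- By Pascal's rule [n+1 choose m+3] and [n+2 choose m+3] compute to `p₁` and `p₂`.
      p₁ = u₂ + q * (q * (q * y)) * u₃
      p₂ = (u₁ + q * (q * y) * u₂) + q * (q * (q * y)) * p₁
      e  = d J * a J
      C  = d (suc J) * a (suc J)
      E  = (C * p₂ + w * (q * w) * (C * u₃) + q * w * (C * ((q * (q * (q * y)) - w) * u₃))) - T-boundary J n

      -- The term j = J+1 of the recurrence balances the change of the certificate from J to J+1.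
      -- Only [n choose m] up to [n choose m+3] are involved, and three consecutive absorptions, at
      -- m, m+1 and m+2, link them.
      E≈ : E ≈ (1# + q * w) * (C * p₁)
      E≈ = begin
        E
          ≈⟨ solve 9 (λ q y w d a u₀ u₁ u₂ u₃ →
               let 1′ = one q
                   p₁ = u₂ :+ q :* (q :* (q :* y)) :* u₃
                   p₂ = (u₁ :+ q :* (q :* y) :* u₂) :+ q :* (q :* (q :* y)) :* p₁
                   C  = d :* (q :* q :* (y :* y)) :* (a :* (1′ :- q :* y))
               in
               (C :* p₂ :+ w :* (q :* w) :* (C :* u₃) :+ q :* w :* (C :* ((q :* (q :* (q :* y)) :- w) :* u₃)))
                 :- q :* w :* (d :* a :* ((y :- w) :* u₀))
               := ((1′ :+ q :* w) :* (C :* p₁)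
                   :+ (d :* a :* (q :* w)) :* (y :* (1′ :- q :* y) :* u₁ :- (y :- w) :* u₀)
                   :+ (:- (d :* a :* (q :* y :* (1′ :- q :* y))))
                        :* (q :* y :* (1′ :- q :* (q :* y)) :* u₂ :- (q :* y :- w) :* u₁)
                   :+ (:- (d :* a :* (q :* q :* q :* y :* y :* (1′ :- q :* y))))
                        :* (q :* (q :* y) :* (1′ :- q :* (q :* (q :* y))) :* u₃ :- (q :* (q :* y) :- w) :* u₂)))
               refl q y w (d J) (a J) u₀ u₁ u₂ u₃ ⟩
        _ ≈⟨ cancel-zero _ _ (qbinom-absorption q n (suc (suc m))) ⟩
        _ ≈⟨ cancel-zero _ _ (qbinom-absorption q n (suc m)) ⟩
        _ ≈⟨ cancel-zero _ _ (qbinom-absorption q n m) ⟩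
        (1# + q * w) * (C * p₁) ∎

    -- Cauchy's identity in base q³

    q³ : Carrier
    q³ = q * (q * q)

    q³^≈ : ∀ j → q³ ^ j ≈ q ^ (j ℕ.* 3)
    q³^≈ zero    = refl
    q³^≈ (suc j) = trans (*-congˡ (q³^≈ j))
      (solve 2 (λ q y → q :* (q :* q) :* y := q :* (q :* (q :* y))) refl q (q ^ (j ℕ.* 3)))

    q³^M≈0 : q³ ^ M ≈ 0#
    q³^M≈0 = trans (q³^≈ M) (^-vanish (M ℕ.* 3) q^M≈0 (ℕ.m≤m*n M 3))

    inv-cancel : ∀ x k → (1# - q ^ suc k) * (x * inv k) ≈ x
    inv-cancel x k = begin
      (1# - q ^ suc k) * (x * inv k)
        ≈⟨ solve 3 (λ x u i → u :* (x :* i) := x :+ x :* (u :* i :- one x)) refl x (1# - q ^ suc k) (inv k) ⟩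
      x + x * ((1# - q ^ suc k) * inv k - 1#)
        ≈⟨ cancel-zero x x (inv-inverse k) ⟩
      x ∎

    d-suc : ∀ j → d (suc j) ≈ d j * (q * q * (q³ ^ j * q³ ^ j))
    d-suc j = *-congˡ (*-congˡ (*-cong (sym (q³^≈ j)) (sym (q³^≈ j))))

    g-suc : ∀ j → (1# - q * (q * q³ ^ j)) * g (suc j) ≈ g j
    g-suc j = trans (*-congʳ (+-congˡ (-‿cong (*-congˡ (*-congˡ (q³^≈ j)))))) (inv-cancel (g j) (suc (j ℕ.* 3)))

    H-suc : ∀ j → (1# - q³ * q³ ^ j) * H (suc j) ≈ H j
    H-suc j = trans (*-congʳ (+-congˡ (-‿cong (q³^≈ (suc j))))) (inv-cancel (H j) (suc (suc (j ℕ.* 3))))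

    F : ℕ → ℕ → Carrier
    F N J = Σ≤ J (λ j → d j * (qbinom q³ N j * g j))

    -- Cauchy's identity 1 / (z ; Q)_N = Σ_j z^j Q^(j² - j) [N choose j]_Q / (z ; Q)_j at
    -- z = q², Q = q³; the correction term makes it telescope in J for the truncated sum.
    F-step : ∀ J N →
      (1# - q * (q * q³ ^ N)) * F (suc N) J + q * q * q³ ^ N * q³ ^ J * (d J * (qbinom q³ N J * g J)) ≈ F N J
    F-step zero N = solve 2 (λ q w →
        let 1′ = one q in
        (1′ :- q :* (q :* w)) :* (1′ :* (1′ :* 1′)) :+ q :* q :* w :* 1′ :* (1′ :* (1′ :* 1′))
        := 1′ :* (1′ :* 1′)) refl q (q³ ^ N)
    F-step (suc J) N = begin
      (1# - q * (q * W)) * (f₁ + d′ * ((v₀ + (q³ * Y) * v₁) * g′)) + q * q * W * (q³ * Y) * (d′ * (v₁ * g′))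
        ≈⟨ solve 12 (λ q Q W Y f₀ f₁ d d′ g g′ v₀ v₁ →
             let 1′ = one q in
             (1′ :- q :* (q :* W)) :* (f₁ :+ d′ :* ((v₀ :+ (Q :* Y) :* v₁) :* g′))
               :+ q :* q :* W :* (Q :* Y) :* (d′ :* (v₁ :* g′))
             := f₀ :+ d′ :* (v₁ :* g′)
               :+ 1′ :* ((1′ :- q :* (q :* W)) :* f₁ :+ q :* q :* W :* Y :* (d :* (v₀ :* g)) :- f₀)
               :+ g′ :* ((1′ :- q :* (q :* W)) :* v₀ :- (1′ :- Q :* Y) :* v₁) :* (d′ :- d :* (q :* q :* (Y :* Y)))
               :+ q :* q :* W :* Y :* d :* v₀ :* ((1′ :- q :* (q :* Y)) :* g′ :- g)
               :+ (:- (d :* (q :* q) :* Y :* g′)) :* (Y :* (1′ :- Q :* Y) :* v₁ :- (Y :- W) :* v₀))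
             refl q q³ W Y f₀ f₁ (d J) d′ (g J) g′ v₀ v₁ ⟩
      _ ≈⟨ cancel-zero _ _ (qbinom-absorption q³ N J) ⟩
      _ ≈⟨ cancel-zero _ _ (g-suc J) ⟩
      _ ≈⟨ cancel-zero _ _ (d-suc J) ⟩
      _ ≈⟨ cancel-zero _ _ (F-step J N) ⟩
      f₀ + d′ * (v₁ * g′) ∎
      where
      W  = q³ ^ N
      Y  = q³ ^ J
      f₀ = F N J
      f₁ = F (suc N) J
      d′ = d (suc J)
      g′ = g (suc J)
      v₀ = qbinom q³ N J
      v₁ = qbinom q³ N (suc J)

    -- In 1 / (q ; q)_3j the factors with exponent 1 modulo 3 cancel against (q ; q³)_j. Those with
    -- exponents 2 and 0 modulo 3 make up `g j` and `H j`.
    a*h : ∀ j → a j * h (j ℕ.* 3) ≈ H j * g j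
    a*h zero    = refl
    a*h (suc j) = begin
      a j * (1# - q * y) * (h (j ℕ.* 3) * i₀ * i₁ * i₂)
        ≈⟨ solve 9 (λ a q y h i₀ i₁ i₂ H g →
             a :* (one q :- q :* y) :* (h :* i₀ :* i₁ :* i₂)
             := (H :* i₂) :* (g :* i₁)
               :+ a :* h :* i₁ :* i₂ :* ((one q :- q :* y) :* i₀ :- one q)
               :+ i₁ :* i₂ :* (a :* h :- H :* g))
             refl (a j) q y (h (j ℕ.* 3)) i₀ i₁ i₂ (H j) (g j) ⟩
      _ ≈⟨ cancel-zero _ _ (a*h j) ⟩
      _ ≈⟨ cancel-zero _ _ (inv-inverse (j ℕ.* 3)) ⟩
      (H j * i₂) * (g j * i₁) ∎
      where
      y  = q ^ (j ℕ.* 3)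
      i₀ = inv (j ℕ.* 3)
      i₁ = inv (suc (j ℕ.* 3))
      i₂ = inv (suc (suc (j ℕ.* 3)))

    -- Both sums tend term by term to the sum of `d j * (H j * g j)`: on the left the binomial has
    -- base `q` and lower index 3j, on the right base `q³` and lower index j. The two bounds say
    -- that every term with j ≤ J has already reached its limit modulo q^M.
    T≈F : ∀ J n N → M ℕ.+ J ℕ.* 3 ℕ.≤ suc n → M ℕ.+ J ℕ.≤ suc N → T J n ≈ F N J
    T≈F J n N n-large N-large = Σ≤-cong J λ j j≤J → begin
      d j * a j * qbinom q n (j ℕ.* 3)
        ≈⟨ *-congˡ (limit q q^M≈0 h refl (λ m → inv-cancel (h m) m) n (j ℕ.* 3)
             (ℕ.≤-trans (ℕ.+-monoʳ-≤ M (ℕ.*-monoˡ-≤ 3 j≤J)) n-large)) ⟩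
      d j * a j * h (j ℕ.* 3)
        ≈⟨ *-assoc _ _ _ ⟩
      d j * (a j * h (j ℕ.* 3))
        ≈⟨ *-congˡ (a*h j) ⟩
      d j * (H j * g j)
        ≈⟨ *-congˡ (*-congʳ (sym (limit q³ q³^M≈0 H refl H-suc N j
             (ℕ.≤-trans (ℕ.+-monoʳ-≤ M j≤J) N-large)))) ⟩
      d j * (qbinom q³ N j * g j) ∎
      where
      limit : ∀ x → x ^ M ≈ 0# →
        (H : ℕ → Carrier) → H 0 ≈ 1# → (∀ m → (1# - x * x ^ m) * H (suc m) ≈ H m) →
        ∀ n m → M ℕ.+ m ℕ.≤ suc n → qbinom x n m ≈ H m
      limit x x^M≈0 H H-zero H-suc n m n-large =
        trans (sym (*-identityˡ _)) (trans (qbinom-limit x x^M≈0 H H-zero H-suc 0 n m n-large) (*-identityˡ _))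

    -- The products (q ; q)_k and (q² ; q³)_N, of which `h k` and `g N` are the inverses.
    poch₁ poch₂ : ℕ → Carrier
    poch₁ zero    = 1#
    poch₁ (suc k) = poch₁ k * (1# - q ^ suc k)
    poch₂ zero    = 1#
    poch₂ (suc N) = poch₂ N * (1# - q ^ suc (suc (N ℕ.* 3)))

    poch₁*h : ∀ k → poch₁ k * h k ≈ 1#
    poch₁*h zero    = *-identityˡ 1#
    poch₁*h (suc k) = trans (*-assoc _ _ _) (trans (*-congˡ (inv-cancel (h k) k)) (poch₁*h k))

    poch₂*g : ∀ N → poch₂ N * g N ≈ 1#
    poch₂*g zero    = *-identityˡ 1#
    poch₂*g (suc N) = trans (*-assoc _ _ _) (trans (*-congˡ (inv-cancel (g N) (suc (N ℕ.* 3)))) (poch₂*g N))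

    F-zero : ∀ J → F 0 J ≈ 1#
    F-zero zero    = trans (*-identityˡ _) (*-identityˡ _)
    F-zero (suc J) = begin
      F 0 J + d (suc J) * (0# * g (suc J)) ≈⟨ +-cong (F-zero J) (trans (*-congˡ (zeroˡ _)) (zeroʳ _)) ⟩
      1# + 0#                              ≈⟨ +-identityʳ 1# ⟩
      1#                                   ∎

    d*-vanish : ∀ J → M ℕ.≤ J → ∀ x y → x * (d J * y) ≈ 0#
    d*-vanish J M≤J x y = trans (*-congˡ (trans (*-congʳ (d-vanish J M≤J)) (zeroˡ y))) (zeroʳ x)

    poch₂*F : ∀ J → M ℕ.≤ J → ∀ N → poch₂ N * F N J ≈ 1#
    poch₂*F J M≤J zero    = trans (*-identityˡ _) (F-zero J)
    poch₂*F J M≤J (suc N) = begin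
      poch₂ N * (1# - q ^ suc (suc (N ℕ.* 3))) * F (suc N) J
        ≈⟨ *-assoc _ _ _ ⟩
      poch₂ N * ((1# - q ^ suc (suc (N ℕ.* 3))) * F (suc N) J)
        ≈⟨ *-congˡ (*-congʳ (+-congˡ (-‿cong (*-congˡ (*-congˡ (sym (q³^≈ N))))))) ⟩
      poch₂ N * ((1# - q * (q * q³ ^ N)) * F (suc N) J)
        ≈⟨ *-congˡ (sym (+-identityʳ _)) ⟩
      poch₂ N * ((1# - q * (q * q³ ^ N)) * F (suc N) J + 0#)
        ≈⟨ *-congˡ (+-congˡ (sym (d*-vanish J M≤J _ _))) ⟩
      poch₂ N * ((1# - q * (q * q³ ^ N)) * F (suc N) J + q * q * q³ ^ N * q³ ^ J * (d J * (qbinom q³ N J * g J)))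
        ≈⟨ *-congˡ (F-step J N) ⟩
      poch₂ N * F N J
        ≈⟨ poch₂*F J M≤J N ⟩
      1# ∎

    T-recurrence : ∀ J → M ℕ.≤ J → ∀ n →
      T J (suc (suc n)) + q ^ n * (q * q ^ n) * T J n ≈ (1# + q * q ^ n) * T J (suc n)
    T-recurrence J M≤J n = begin
      T J (suc (suc n)) + q ^ n * (q * q ^ n) * T J n                  ≈⟨ sym (+-identityʳ _) ⟩
      T J (suc (suc n)) + q ^ n * (q * q ^ n) * T J n + 0#             ≈⟨ +-congˡ (sym boundary≈0) ⟩
      T J (suc (suc n)) + q ^ n * (q * q ^ n) * T J n + T-boundary J n ≈⟨ T-step J n ⟩
      (1# + q * q ^ n) * T J (suc n)                                   ∎
      where
      boundary≈0 : T-boundary J n ≈ 0#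
      boundary≈0 = trans (*-congˡ (*-assoc _ _ _)) (d*-vanish J M≤J _ _)

    T-zero : ∀ J → T J 0 ≈ 1#
    T-zero zero    = trans (*-congʳ (*-identityˡ _)) (*-identityˡ _)
    T-zero (suc J) = trans (+-cong (T-zero J) (zeroʳ _)) (+-identityʳ _)

    T-one : ∀ J → T J 1 ≈ 1#
    T-one zero    = trans (*-congʳ (*-identityˡ _)) (*-identityˡ _)
    T-one (suc J) = trans (+-cong (T-one J) (trans (*-congˡ (trans (+-identityˡ _) (zeroʳ _))) (zeroʳ _))) (+-identityʳ _)

    -- Solving the overpartition recurrences

    module _
      (free barred free/ all/ : ℕ → Carrier)
      (free-zero : free 0 ≈ 0#) (barred-zero : barred 0 ≈ 1#)
      (free/-suc : ∀ k → (1# - q ^ suc k) * free/ k ≈ free k)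
      (all/-suc : ∀ k → (1# - q ^ suc k) * all/ k ≈ free k + barred k)
      (free-suc : ∀ k → free (suc k) ≈ free/ k + barred k)
      (barred-suc : ∀ k → barred (suc k) ≈ q ^ suc k * all/ k)
      (J : ℕ) (M≤J : M ℕ.≤ J)
      where

      -- Since b_k is q^k / (1 - q^k) times the previous total, (q ; q)_k b_k depends on T_k alone.
      -- This eliminates a_k: the recurrences give (q ; q)_(k+1) (a_(k+1) + b_(k+1)) = (1 + q^(k+1))
      -- T_(k+1) - q^(k+1) (q ; q)_k b_k, and the last product is q^(2k+1) T_k. The value T_0 = 1
      -- fits b_0 = 1.
      poch₁*barred : ∀ k → poch₁ k * barred k ≈ q ^ k * T J k
      poch₁*all    : ∀ k → poch₁ k * (free k + barred k) ≈ T J (suc k)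

      poch₁*barred zero = begin
        1# * barred 0 ≈⟨ *-congˡ barred-zero ⟩
        1# * 1#       ≈⟨ *-congˡ (sym (T-zero J)) ⟩
        1# * T J 0    ∎
      poch₁*barred (suc k) = begin
        poch₁ k * (1# - q ^ suc k) * barred (suc k)
          ≈⟨ *-congˡ (barred-suc k) ⟩
        poch₁ k * (1# - q ^ suc k) * (q ^ suc k * all/ k)
          ≈⟨ solve 4 (λ p u x c → p :* u :* (x :* c) := x :* (p :* (u :* c))) refl _ _ _ _ ⟩
        q ^ suc k * (poch₁ k * ((1# - q ^ suc k) * all/ k))
          ≈⟨ *-congˡ (*-congˡ (all/-suc k)) ⟩
        q ^ suc k * (poch₁ k * (free k + barred k))
          ≈⟨ *-congˡ (poch₁*all k) ⟩
        q ^ suc k * T J (suc k) ∎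

      poch₁*all zero = begin
        1# * (free 0 + barred 0) ≈⟨ *-identityˡ _ ⟩
        free 0 + barred 0        ≈⟨ +-cong free-zero barred-zero ⟩
        0# + 1#                  ≈⟨ +-identityˡ 1# ⟩
        1#                       ≈⟨ sym (T-one J) ⟩
        T J 1                    ∎
      poch₁*all (suc k) = begin
        poch₁ k * (1# - q ^ suc k) * (free (suc k) + barred (suc k))
          ≈⟨ *-congˡ (+-cong (free-suc k) (barred-suc k)) ⟩
        poch₁ k * (1# - q ^ suc k) * (free/ k + barred k + q ^ suc k * all/ k)
          ≈⟨ solve 10 (λ p q w b o c f t₀ t₁ t₂ →
               p :* (one q :- q :* w) :* (b :+ o :+ q :* w :* c)
               := t₂
                 :+ p :* ((one q :- q :* w) :* b :- f)
                 :+ p :* (q :* w) :* ((one q :- q :* w) :* c :- (f :+ o))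
                 :+ (one q :+ q :* w) :* (p :* (f :+ o) :- t₁)
                 :+ (:- (q :* w)) :* (p :* o :- w :* t₀)
                 :+ (:- one q) :* ((t₂ :+ w :* (q :* w) :* t₀) :- (one q :+ q :* w) :* t₁))
               refl (poch₁ k) q (q ^ k) (free/ k) (barred k) (all/ k) (free k) (T J k) (T J (suc k)) (T J (suc (suc k))) ⟩
        _ ≈⟨ cancel-zero _ _ (T-recurrence J M≤J k) ⟩
        _ ≈⟨ cancel-zero _ _ (poch₁*barred k) ⟩
        _ ≈⟨ cancel-zero _ _ (poch₁*all k) ⟩
        _ ≈⟨ cancel-zero _ _ (all/-suc k) ⟩
        _ ≈⟨ cancel-zero _ _ (free/-suc k) ⟩
        T J (suc (suc k)) ∎

      -- Multiplied by (q ; q)_K, the total becomes `T J (suc K)`, which equals `F N J` and hence 1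
      -- / (q² ; q³)_N. The bound K = 3N is taken because there the two-colour product ends with a
      -- complete period of residues.
      all≈h*g : ∀ N → M ℕ.+ J ℕ.* 3 ℕ.≤ suc (suc (N ℕ.* 3)) → M ℕ.+ J ℕ.≤ suc N →
        free (N ℕ.* 3) + barred (N ℕ.* 3) ≈ h (N ℕ.* 3) * g N
      all≈h*g N K-large N-large = begin
        s
          ≈⟨ solve 6 (λ s p h P g F →
               s := h :* g
                 :+ (:- s) :* (p :* h :- one s)
                 :+ (:- (p :* s :* h)) :* (P :* g :- one s)
                 :+ h :* P :* g :* (p :* s :- F)
                 :+ h :* g :* (P :* F :- one s))
               refl s (poch₁ K) (h K) (poch₂ N) (g N) (F N J) ⟩
        _ ≈⟨ cancel-zero _ _ (poch₂*F J M≤J N) ⟩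
        _ ≈⟨ cancel-zero _ _ (trans (poch₁*all K) (T≈F J (suc K) N K-large N-large)) ⟩
        _ ≈⟨ cancel-zero _ _ (poch₂*g N) ⟩
        _ ≈⟨ cancel-zero _ _ (poch₁*h K) ⟩
        h K * g N ∎
        where
        K = N ℕ.* 3
        s = free K + barred K

    -- The two-colour product

    module _
      (coloured green/ : ℕ → Carrier)
      (coloured-zero : coloured 0 ≈ 1#)
      (one-mod-three  : ∀ N → (1# - q ^ suc (N ℕ.* 3)) * coloured (suc (N ℕ.* 3)) ≈ coloured (N ℕ.* 3))
      (two-mod-three  : ∀ N → (1# - q ^ suc (suc (N ℕ.* 3))) * coloured (suc (suc (N ℕ.* 3))) ≈ green/ N)
      (green/-suc     : ∀ N → (1# - q ^ suc (suc (N ℕ.* 3))) * green/ N ≈ coloured (suc (N ℕ.* 3)))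
      (zero-mod-three : ∀ N → (1# - q ^ suc (suc (suc (N ℕ.* 3)))) * coloured (suc N ℕ.* 3)
                              ≈ coloured (suc (suc (N ℕ.* 3))))
      where

      divide : ∀ k {x y} → (1# - q ^ suc k) * x ≈ y → x ≈ y * inv k
      divide k {x} {y} eq = begin
        x
          ≈⟨ solve 4 (λ x y u i → x := y :* i :+ i :* (u :* x :- y) :+ (:- x) :* (u :* i :- one x))
               refl x y (1# - q ^ suc k) (inv k) ⟩
        _ ≈⟨ cancel-zero _ _ (inv-inverse k) ⟩
        _ ≈⟨ cancel-zero _ _ eq ⟩
        y * inv k ∎

      -- Valid for every `N`, without a largeness condition: a period of three sizes contributes one
      -- inverse factor per red size and a second `i₁` for the green parts 3N+2.
      coloured≈h*g : ∀ N → coloured (N ℕ.* 3) ≈ h (N ℕ.* 3) * g N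
      coloured≈h*g zero    = trans coloured-zero (sym (*-identityˡ 1#))
      coloured≈h*g (suc N) = begin
        coloured (suc N ℕ.* 3)
          ≈⟨ divide _ (zero-mod-three N) ⟩
        coloured (suc (suc (N ℕ.* 3))) * i₂
          ≈⟨ *-congʳ (divide _ (two-mod-three N)) ⟩
        green/ N * i₁ * i₂
          ≈⟨ *-congʳ (*-congʳ (divide _ (green/-suc N))) ⟩
        coloured (suc (N ℕ.* 3)) * i₁ * i₁ * i₂
          ≈⟨ *-congʳ (*-congʳ (*-congʳ (divide _ (one-mod-three N)))) ⟩
        coloured (N ℕ.* 3) * i₀ * i₁ * i₁ * i₂
          ≈⟨ *-congʳ (*-congʳ (*-congʳ (*-congʳ (coloured≈h*g N)))) ⟩
        h (N ℕ.* 3) * g N * i₀ * i₁ * i₁ * i₂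
          ≈⟨ solve 5 (λ h g i₀ i₁ i₂ → h :* g :* i₀ :* i₁ :* i₁ :* i₂ := h :* i₀ :* i₁ :* i₂ :* (g :* i₁))
               refl (h (N ℕ.* 3)) (g N) i₀ i₁ i₂ ⟩
        h (N ℕ.* 3) * i₀ * i₁ * i₂ * (g N * i₁) ∎
        where
        i₀ = inv (N ℕ.* 3)
        i₁ = inv (suc (N ℕ.* 3))
        i₂ = inv (suc (suc (N ℕ.* 3)))

open import Data.Nat using (_+_; _*_; _≤_; _<_; _≥_; _≟_; _≤?_)
open ≡ using (refl; cong; cong₂; subst; module ≡-Reasoning)

-- Truncated power series

unit : ℕ → ℕ
unit zero    = 1
unit (suc n) = 0

shift : ℕ → (ℕ → ℕ) → ℕ → ℕ
shift zero    f n       = f n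
shift (suc k) f zero    = 0
shift (suc k) f (suc n) = shift k f n

-- geometric k f and carry k f i are the coefficient sequences of f / (1 - q ^ (k + 1))
-- and of q ^ (i + 1) * f / (1 - q ^ (k + 1)).
geometric : ℕ → (ℕ → ℕ) → ℕ → ℕ
carry     : ℕ → (ℕ → ℕ) → ℕ → ℕ → ℕ
geometric k f n           = f n + carry k f k n
carry k f i       zero    = 0
carry k f zero    (suc n) = geometric k f n
carry k f (suc i) (suc n) = carry k f i n

-- The delayed recursion of `geometric` is not structural when written with `shift`. In `carry` the
-- delay is counted down together with the index, and this lemma recovers the intended meaning.
carry≡shift : ∀ k f i n → carry k f i n ≡ shift (suc i) (geometric k f) n
carry≡shift k f i       zero    = refl
carry≡shift k f zero    (suc n) = refl
carry≡shift k f (suc i) (suc n) = carry≡shift k f i n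

module TruncatedPowerSeries (N : ℕ) where

  Series : Set
  Series = ℕ → ℤ

  -- Comparing coefficients only up to `N` is what makes `q` nilpotent. The record wrapper lets `f`
  -- and `g` be inferred from a proof.
  record _≈_ (f g : Series) : Set where
    constructor coefficientwise
    field coefficient : ∀ n → n ≤ N → f n ≡ g n
  open _≈_ public

  infix  4 _≈_
  infixl 6 _⊕_
  infixl 7 _⊛_

  -- The Cauchy product, by splitting the left factor into its constant term and `q` times its tail.
  _⊕_ _⊛_ : Series → Series → Series
  (f ⊕ g) n       = f n ℤ.+ g n
  (f ⊛ g) zero    = f 0 ℤ.* g 0
  (f ⊛ g) (suc n) = f 0 ℤ.* g (suc n) ℤ.+ ((f ∘ suc) ⊛ g) n

  constant : ℤ → Series
  constant c zero    = c
  constant c (suc n) = 0ℤ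

  0ˢ 1ˢ : Series
  0ˢ _ = 0ℤ
  1ˢ   = constant 1ℤ

  ⊛-cong : ∀ n {f f′ g g′} → (∀ i → i ≤ n → f i ≡ f′ i) → (∀ i → i ≤ n → g i ≡ g′ i) →
    (f ⊛ g) n ≡ (f′ ⊛ g′) n
  ⊛-cong zero    f≡f′ g≡g′ = cong₂ ℤ._*_ (f≡f′ 0 z≤n) (g≡g′ 0 z≤n)
  ⊛-cong (suc n) f≡f′ g≡g′ = cong₂ ℤ._+_
    (cong₂ ℤ._*_ (f≡f′ 0 z≤n) (g≡g′ (suc n) ℕ.≤-refl))
    (⊛-cong n (λ i i≤n → f≡f′ (suc i) (s≤s i≤n)) (λ i i≤n → g≡g′ i (ℕ.m≤n⇒m≤1+n i≤n)))

  ⊛-distribʳ : ∀ n h f g → ((f ⊕ g) ⊛ h) n ≡ (f ⊛ h) n ℤ.+ (g ⊛ h) n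
  ⊛-distribʳ zero    h f g = ℤ.*-distribʳ-+ (h 0) (f 0) (g 0)
  ⊛-distribʳ (suc n) h f g = ≡.trans
    (cong (ℤ._+_ ((f 0 ℤ.+ g 0) ℤ.* h (suc n))) (⊛-distribʳ n h (f ∘ suc) (g ∘ suc)))
    (rearrange (f 0) (g 0) (h (suc n)) _ _)
    where
    rearrange : ∀ a b c x y → (a ℤ.+ b) ℤ.* c ℤ.+ (x ℤ.+ y) ≡ (a ℤ.* c ℤ.+ x) ℤ.+ (b ℤ.* c ℤ.+ y)
    rearrange = solve-∀

  ⊛-scale : ∀ n c f g → ((λ i → c ℤ.* f i) ⊛ g) n ≡ c ℤ.* (f ⊛ g) n
  ⊛-scale zero    c f g = ℤ.*-assoc c (f 0) (g 0)
  ⊛-scale (suc n) c f g = ≡.trans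
    (cong (ℤ._+_ (c ℤ.* f 0 ℤ.* g (suc n))) (⊛-scale n c (f ∘ suc) g))
    (rearrange c (f 0) (g (suc n)) _)
    where
    rearrange : ∀ a b c x → a ℤ.* b ℤ.* c ℤ.+ a ℤ.* x ≡ a ℤ.* (b ℤ.* c ℤ.+ x)
    rearrange = solve-∀

  -- The mirror image of the defining recursion, peeling the right factor instead of the left.
  -- Commutativity follows by playing the two against each other.
  ⊛-sucʳ : ∀ n f g → (f ⊛ g) (suc n) ≡ (f ⊛ (g ∘ suc)) n ℤ.+ f (suc n) ℤ.* g 0
  ⊛-sucʳ zero    f g = refl
  ⊛-sucʳ (suc n) f g = ≡.trans
    (cong (ℤ._+_ (f 0 ℤ.* g (suc (suc n)))) (⊛-sucʳ n (f ∘ suc) g))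
    (≡.sym (ℤ.+-assoc (f 0 ℤ.* g (suc (suc n))) _ _))

  ⊛-comm : ∀ n f g → (f ⊛ g) n ≡ (g ⊛ f) n
  ⊛-comm zero    f g = ℤ.*-comm (f 0) (g 0)
  ⊛-comm (suc n) f g = begin
    f 0 ℤ.* g (suc n) ℤ.+ ((f ∘ suc) ⊛ g) n ≡⟨ cong₂ ℤ._+_ (ℤ.*-comm (f 0) (g (suc n))) (⊛-comm n (f ∘ suc) g) ⟩
    g (suc n) ℤ.* f 0 ℤ.+ (g ⊛ (f ∘ suc)) n ≡⟨ ℤ.+-comm (g (suc n) ℤ.* f 0) _ ⟩
    (g ⊛ (f ∘ suc)) n ℤ.+ g (suc n) ℤ.* f 0 ≡⟨ ⊛-sucʳ n g f ⟨
    (g ⊛ f) (suc n)                         ∎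
    where open ≡-Reasoning

  ⊛-assoc : ∀ n f g h → ((f ⊛ g) ⊛ h) n ≡ (f ⊛ (g ⊛ h)) n
  ⊛-assoc zero    f g h = ℤ.*-assoc (f 0) (g 0) (h 0)
  ⊛-assoc (suc n) f g h = begin
    f 0 ℤ.* g 0 ℤ.* h (suc n) ℤ.+ (((λ i → f 0 ℤ.* g (suc i)) ⊕ ((f ∘ suc) ⊛ g)) ⊛ h) n
      ≡⟨ cong (ℤ._+_ (f 0 ℤ.* g 0 ℤ.* h (suc n))) (⊛-distribʳ n h _ _) ⟩
    f 0 ℤ.* g 0 ℤ.* h (suc n) ℤ.+ (((λ i → f 0 ℤ.* g (suc i)) ⊛ h) n ℤ.+ (((f ∘ suc) ⊛ g) ⊛ h) n)
      ≡⟨ cong (ℤ._+_ (f 0 ℤ.* g 0 ℤ.* h (suc n)))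
           (cong₂ ℤ._+_ (⊛-scale n (f 0) (g ∘ suc) h) (⊛-assoc n (f ∘ suc) g h)) ⟩
    f 0 ℤ.* g 0 ℤ.* h (suc n) ℤ.+ (f 0 ℤ.* ((g ∘ suc) ⊛ h) n ℤ.+ ((f ∘ suc) ⊛ (g ⊛ h)) n)
      ≡⟨ rearrange (f 0) (g 0) (h (suc n)) _ _ ⟩
    f 0 ℤ.* (g 0 ℤ.* h (suc n) ℤ.+ ((g ∘ suc) ⊛ h) n) ℤ.+ ((f ∘ suc) ⊛ (g ⊛ h)) n ∎
    where
    open ≡-Reasoning
    rearrange : ∀ a b c x y → a ℤ.* b ℤ.* c ℤ.+ (a ℤ.* x ℤ.+ y) ≡ a ℤ.* (b ℤ.* c ℤ.+ x) ℤ.+ y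
    rearrange = solve-∀

  ⊛-zeroˡ : ∀ n f → (0ˢ ⊛ f) n ≡ 0ℤ
  ⊛-zeroˡ zero    f = refl
  ⊛-zeroˡ (suc n) f = ≡.trans (ℤ.+-identityˡ _) (⊛-zeroˡ n f)

  ⊛-identityˡ : ∀ n f → (1ˢ ⊛ f) n ≡ f n
  ⊛-identityˡ zero    f = ℤ.*-identityˡ (f 0)
  ⊛-identityˡ (suc n) f =
    ≡.trans (cong₂ ℤ._+_ (ℤ.*-identityˡ (f (suc n))) (⊛-zeroˡ n f)) (ℤ.+-identityʳ (f (suc n)))

  pointwise : ∀ {f g} → (∀ n → f n ≡ g n) → f ≈ g
  pointwise f≡g = coefficientwise λ n _ → f≡g n

  commutativeRing : CommutativeRing _ _
  commutativeRing = record
    { Carrier = Series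
    ; _≈_     = _≈_
    ; _+_     = _⊕_
    ; _*_     = _⊛_
    ; -_      = ℤ.-_ ∘_
    ; 0#      = 0ˢ
    ; 1#      = 1ˢ
    ; isCommutativeRing = record
      { isRing = record
        { +-isAbelianGroup = record
          { isGroup = record
            { isMonoid = record
              { isSemigroup = record
                { isMagma = record
                  { isEquivalence = record
                    { refl  = pointwise λ _ → refl
                    ; sym   = λ p → coefficientwise λ n n≤N → ≡.sym (coefficient p n n≤N)
                    ; trans = λ p r → coefficientwise λ n n≤N → ≡.trans (coefficient p n n≤N) (coefficient r n n≤N)
                    }
                  ; ∙-cong = λ p r → coefficientwise λ n n≤N → cong₂ ℤ._+_ (coefficient p n n≤N) (coefficient r n n≤N)
                  }
                ; assoc = λ f g h → pointwise λ n → ℤ.+-assoc (f n) (g n) (h n)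
                }
              ; identity = (λ f → pointwise λ n → ℤ.+-identityˡ (f n)) , (λ f → pointwise λ n → ℤ.+-identityʳ (f n))
              }
            ; inverse = (λ f → pointwise λ n → ℤ.+-inverseˡ (f n)) , (λ f → pointwise λ n → ℤ.+-inverseʳ (f n))
            ; ⁻¹-cong = λ p → coefficientwise λ n n≤N → cong ℤ.-_ (coefficient p n n≤N)
            }
          ; comm = λ f g → pointwise λ n → ℤ.+-comm (f n) (g n)
          }
        ; *-cong = λ p r → coefficientwise λ n n≤N → ⊛-cong n
            (λ i i≤n → coefficient p i (ℕ.≤-trans i≤n n≤N)) (λ i i≤n → coefficient r i (ℕ.≤-trans i≤n n≤N))
        ; *-assoc = λ f g h → pointwise λ n → ⊛-assoc n f g h
        ; *-identity = (λ f → pointwise λ n → ⊛-identityˡ n f) ,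
                       (λ f → pointwise λ n → ≡.trans (⊛-comm n f 1ˢ) (⊛-identityˡ n f))
        ; distrib = (λ f g h → pointwise λ n → ≡.trans (⊛-comm n f (g ⊕ h))
                      (≡.trans (⊛-distribʳ n f g h) (cong₂ ℤ._+_ (⊛-comm n g f) (⊛-comm n h f)))) ,
                    (λ f g h → pointwise λ n → ⊛-distribʳ n f g h)
        }
      ; *-comm = λ f g → pointwise λ n → ⊛-comm n f g
      }
    }

  open CommutativeRing commutativeRing using (_-_; 1#; 0#; commutativeSemiring; setoid)
  module R = CommutativeRing commutativeRing
  open import Algebra.Properties.CommutativeSemiring.Exp commutativeSemiring using (_^_)
  open import Algebra.Properties.Ring R.ring using (-‿distribˡ-*)

  constant-homomorphism :
    CommutativeRing.rawRing ℤ.+-*-commutativeRing -Raw-AlmostCommutative⟶ fromCommutativeRing commutativeRing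
  constant-homomorphism = record
    { ⟦_⟧    = constant
    ; +-homo = λ a b → pointwise λ { zero → refl ; (suc n) → refl }
    ; *-homo = λ a b → pointwise λ
        { zero    → refl
        ; (suc n) → ≡.sym (≡.trans (cong₂ ℤ._+_ (ℤ.*-zeroʳ a) (⊛-zeroˡ n (constant b))) refl)
        }
    ; -‿homo = λ a → pointwise λ { zero → refl ; (suc n) → refl }
    ; 0-homo = pointwise λ { zero → refl ; (suc n) → refl }
    ; 1-homo = R.refl
    }

  q : Series
  q zero    = 0ℤ
  q (suc n) = 1ˢ n

  q*-suc : ∀ f n → (q ⊛ f) (suc n) ≡ f n
  q*-suc f n = ≡.trans (ℤ.+-identityˡ _) (⊛-identityˡ n f)

  q^-below : ∀ k n → suc n ≤ k → (q ^ k) n ≡ 0ℤ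
  q^-below (suc k) zero    p       = refl
  q^-below (suc k) (suc n) (s≤s p) = ≡.trans (q*-suc (q ^ k) n) (q^-below k n p)

  q^[1+N]≈0 : q ^ suc N ≈ 0#
  q^[1+N]≈0 = coefficientwise λ n n≤N → q^-below (suc N) n (s≤s n≤N)

  series : (ℕ → ℕ) → Series
  series f n = pos (f n)

  series-injective : ∀ {f g} → series f ≈ series g → f N ≡ g N
  series-injective p = ℤ.+-injective (coefficient p N ℕ.≤-refl)

  shift-coefficient : ∀ k f n → (q ^ k ⊛ series f) n ≡ pos (shift k f n)
  shift-coefficient zero    f n       = ⊛-identityˡ n (series f)
  shift-coefficient (suc k) f zero    = refl
  shift-coefficient (suc k) f (suc n) = begin
    (q ⊛ q ^ k ⊛ series f) (suc n)   ≡⟨ ⊛-assoc (suc n) q (q ^ k) (series f) ⟩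
    (q ⊛ (q ^ k ⊛ series f)) (suc n)   ≡⟨ q*-suc (q ^ k ⊛ series f) n ⟩
    (q ^ k ⊛ series f) n               ≡⟨ shift-coefficient k f n ⟩
    pos (shift k f n)                  ∎
    where open ≡-Reasoning

  series-shift : ∀ k f → series (shift k f) ≈ q ^ k ⊛ series f
  series-shift k f = pointwise λ n → ≡.sym (shift-coefficient k f n)

  series-geometric : ∀ k f → (1# - q ^ suc k) ⊛ series (geometric k f) ≈ series f
  series-geometric k f = begin
    (1# - Q) ⊛ G                       ≈⟨ R.distribʳ G 1# (R.- Q) ⟩
    1# ⊛ G ⊕ (R.- Q) ⊛ G               ≈⟨ R.+-cong (R.*-identityˡ G) (R.sym (-‿distribˡ-* Q G)) ⟩
    G ⊕ (R.- (Q ⊛ G))                  ≈⟨ R.+-congʳ G≈ ⟩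
    (series f ⊕ Q ⊛ G) ⊕ (R.- (Q ⊛ G)) ≈⟨ R.+-assoc (series f) (Q ⊛ G) _ ⟩
    series f ⊕ (Q ⊛ G - Q ⊛ G)         ≈⟨ R.+-congˡ {series f} (R.-‿inverseʳ (Q ⊛ G)) ⟩
    series f ⊕ 0#                      ≈⟨ R.+-identityʳ (series f) ⟩
    series f                           ∎
    where
    open import Relation.Binary.Reasoning.Setoid setoid
    Q = q ^ suc k
    G = series (geometric k f)
    G≈ : G ≈ series f ⊕ Q ⊛ G
    G≈ = pointwise λ n → cong (λ c → pos (f n) ℤ.+ c)
      (≡.trans (cong pos (carry≡shift k f k n)) (≡.sym (shift-coefficient (suc k) (geometric k f) n)))

  series-unit : series unit ≈ 1#
  series-unit = pointwise λ { zero → refl ; (suc n) → refl }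

-- Counting lists

module _ {A : Set} where

  cardinality-resp : ∀ {P Q : A → Set} {N} → (∀ x → P x ⇔ Q x) → HasCardinality P N → HasCardinality Q N
  cardinality-resp P⇔Q (xs , unique , ∈⇔P , len) =
    xs , unique , (λ x → mk⇔ (to (P⇔Q x) ∘ to (∈⇔P x)) (from (∈⇔P x) ∘ from (P⇔Q x))) , len
    where open Equivalence

  cardinality-∅ : ∀ {P : A → Set} → (∀ x → ¬ P x) → HasCardinality P 0
  cardinality-∅ ¬P = [] , [] , (λ x → mk⇔ (λ ()) (⊥-elim ∘ ¬P x)) , refl

  cardinality-≡ : ∀ (a : A) → HasCardinality (_≡ a) 1
  cardinality-≡ a = a ∷ [] , [] ∷ [] , (λ x → mk⇔ (λ { (here eq) → eq ; (there ()) }) here) , refl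

  cardinality-⊎ : ∀ {P Q : A → Set} {M N} → (∀ x → P x → ¬ Q x) →
    HasCardinality P M → HasCardinality Q N → HasCardinality (λ x → P x ⊎ Q x) (M + N)
  cardinality-⊎ disjoint (xs , xs! , ∈⇔P , lenP) (ys , ys! , ∈⇔Q , lenQ) =
    xs ++ ys ,
    Unique.++⁺ xs! ys! (λ { {x} (x∈xs , x∈ys) → disjoint x (to (∈⇔P x) x∈xs) (to (∈⇔Q x) x∈ys) }) ,
    (λ x → mk⇔
      ([ inj₁ ∘ to (∈⇔P x) , inj₂ ∘ to (∈⇔Q x) ]′ ∘ ∈-++⁻ xs)
      [ ∈-++⁺ˡ ∘ from (∈⇔P x) , ∈-++⁺ʳ xs ∘ from (∈⇔Q x) ]′) ,
    ≡.trans (List.length-++ xs) (cong₂ _+_ lenP lenQ)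
    where open Equivalence

  cardinality-map : ∀ {B : Set} {P : A → Set} {N} (f : A → B) → (∀ {x y} → f x ≡ f y → x ≡ y) →
    HasCardinality P N → HasCardinality (λ y → ∃[ x ] (P x × y ≡ f x)) N
  cardinality-map f f-injective (xs , xs! , ∈⇔P , len) =
    map f xs ,
    Unique.map⁺ f-injective xs! ,
    (λ y → mk⇔
      (λ y∈ → let (x , x∈xs , y≡fx) = ∈-map⁻ f y∈ in x , to (∈⇔P x) x∈xs , y≡fx)
      (λ { (x , px , refl) → ∈-map⁺ f (from (∈⇔P x) px) })) ,
    ≡.trans (List.length-map f xs) len
    where open Equivalence

module _ {A : Set} where

  Family : Set₁
  Family = ℕ → List A → Set

  Counts : Family → (ℕ → ℕ) → Set
  Counts P f = ∀ n → HasCardinality (P n) (f n)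

  -- The weight `w` is independent of the letter `x`, so that counting can lower it one unit at a
  -- time together with `n`.
  data Cons (x : A) (w : ℕ) (P : Family) : Family where
    cons : ∀ {n xs} → P n xs → Cons x w P (w + n) (x ∷ xs)

  data Repeat (x : A) (w : ℕ) (P : Family) : Family where
    stop  : ∀ {n xs} → P n xs → Repeat x w P n xs
    again : ∀ {n xs} → Repeat x w P n xs → Repeat x w P (w + n) (x ∷ xs)

  Nil : Family
  Nil n xs = n ≡ 0 × xs ≡ []

  count-Nil : Counts Nil unit
  count-Nil zero    = cardinality-resp (λ xs → mk⇔ (refl ,_) proj₂) (cardinality-≡ [])
  count-Nil (suc n) = cardinality-∅ (λ { xs () })

  cons-step : ∀ {x k P n xs} → Cons x k P n xs ⇔ Cons x (suc k) P (suc n) xs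
  cons-step = mk⇔ (λ { (cons p) → cons p }) (λ { (cons p) → cons p })

  count-Cons₀ : ∀ {x P N} n → HasCardinality (P n) N → HasCardinality (Cons x 0 P n) N
  count-Cons₀ {x} n = cardinality-resp (λ _ → mk⇔ (λ { (xs , p , refl) → cons p }) (λ { (cons p) → _ , p , refl }))
    ∘ cardinality-map (x ∷_) List.∷-injectiveʳ

  count-Cons : ∀ {x P f} → Counts P f → ∀ k → Counts (Cons x k P) (shift k f)
  count-Cons countP zero    n       = count-Cons₀ n (countP n)
  count-Cons countP (suc k) zero    = cardinality-∅ (λ { xs () })
  count-Cons countP (suc k) (suc n) = cardinality-resp (λ _ → cons-step) (count-Cons countP k n)

  module _ {x : A} {P : Family} {f} (fresh : ∀ n xs → ¬ P n (x ∷ xs)) (countP : Counts P f) (k : ℕ) where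

    repeat-⇔ : ∀ n xs → (P n xs ⊎ Cons x (suc k) (Repeat x (suc k) P) n xs) ⇔ Repeat x (suc k) P n xs
    repeat-⇔ n xs = mk⇔
      (λ { (inj₁ p) → stop p ; (inj₂ (cons r)) → again r })
      (λ { (stop p) → inj₁ p ; (again r) → inj₂ (cons r) })

    -- The clauses follow those of `geometric` and `carry`, with `i` counting down the weight of the
    -- copy of `x` in front. `fresh` makes `stop` and `again` exclusive, and the positive weight k+1
    -- bounds the number of copies.
    count-Repeat : Counts (Repeat x (suc k) P) (geometric k f)
    count-carry  : ∀ i → Counts (Cons x (suc i) (Repeat x (suc k) P)) (carry k f i)

    count-Repeat n = cardinality-resp (repeat-⇔ n)
      (cardinality-⊎ (λ { _ p (cons r) → fresh n _ p }) (countP n) (count-carry k n))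
    count-carry i       zero    = cardinality-∅ (λ { xs () })
    count-carry zero    (suc n) = cardinality-resp (λ _ → cons-step) (count-Cons₀ n (count-Repeat n))
    count-carry (suc i) (suc n) = cardinality-resp (λ _ → cons-step) (count-carry i n)

module _ {A : Set} where

  weight : List (ℕ × A) → ℕ
  weight = sum ∘ map proj₁

  BoundedBy : ℕ → List (ℕ × A) → Set
  BoundedBy k = All λ p → 0 < proj₁ p × proj₁ p ≤ k

  -- All pairs rather than neighbours, so that the head constrains every later part directly.
  Decreasing : (ℕ × A → ℕ × A → Set) → List (ℕ × A) → Set
  Decreasing R = AllPairs λ p q → proj₁ q ≤ proj₁ p × R p q

  bounded-weaken : ∀ {k l xs} → k ≤ l → BoundedBy k xs → BoundedBy l xs
  bounded-weaken k≤l = All.map λ { (0<p , ≤k) → 0<p , ℕ.≤-trans ≤k k≤l }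

  bounded-head-absent : ∀ {k x xs} → ¬ BoundedBy k ((suc k , x) ∷ xs)
  bounded-head-absent ((_ , sk≤k) ∷ _) = ℕ.1+n≰n sk≤k

  parts≤weight : ∀ xs → All (λ p → proj₁ p ≤ weight xs) xs
  parts≤weight []       = []
  parts≤weight (p ∷ xs) =
    ℕ.m≤m+n (proj₁ p) (weight xs) ∷ All.map (λ ≤w → ℕ.≤-trans ≤w (ℕ.m≤n+m (weight xs) (proj₁ p))) (parts≤weight xs)

  bounded-of-small-head : ∀ {R k x xs} → Decreasing R (x ∷ xs) → All (λ p → 0 < proj₁ p) (x ∷ xs) →
    proj₁ x ≤ k → BoundedBy k (x ∷ xs)
  bounded-of-small-head (x≽ ∷ _) (px ∷ pxs) x≤k =
    (px , x≤k) ∷ All.zip (pxs , All.map (λ r → ℕ.≤-trans (proj₁ r) x≤k) x≽)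

  bounded-positive : ∀ {k xs} → BoundedBy k xs → All (λ p → 0 < proj₁ p) xs
  bounded-positive = All.map proj₁

  -- The overline and colour orders compose only along weakly decreasing sizes, hence the size
  -- hypotheses in the transitivity assumption.
  decreasing : ∀ {R} → (∀ p q r → proj₁ q ≤ proj₁ p → R p q → proj₁ r ≤ proj₁ q → R q r → R p r) →
    ∀ {xs} → Linked _≥_ (map proj₁ xs) → Linked R xs → Decreasing R xs
  decreasing R-trans ≥-linked R-linked = Linked.Linked⇒AllPairs
    (λ { {p} {q} {r} (q≤p , Rpq) (r≤q , Rqr) → ℕ.≤-trans r≤q q≤p , R-trans p q r q≤p Rpq r≤q Rqr })
    (Linked.zip (Linked.map⁻ ≥-linked , R-linked))

  isPartition : ∀ {R k xs} → Decreasing R xs → BoundedBy k xs → IsPartition (weight xs) (map proj₁ xs)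
  isPartition sorted bound = record
    { positive      = All.map⁺ (bounded-positive bound)
    ; nonIncreasing = Linked.map⁺ (Linked.map proj₁ (Linked.AllPairs⇒Linked sorted))
    ; total         = refl
    }

  partition-bounded : ∀ {n k xs} → n ≤ k → IsPartition n (map proj₁ xs) → BoundedBy k xs
  partition-bounded {xs = xs} n≤k p = All.zip (All.map⁻ positive ,
      All.map (λ ≤w → ℕ.≤-trans ≤w (ℕ.≤-trans (ℕ.≤-reflexive total) n≤k)) (parts≤weight xs))
    where open IsPartition p

-- Overpartitions

-- Admissible overpartitions with parts at most k in which k is not overlined, is overlined,
-- or either. The part 0 counts as overlined, which turns the condition on the part 1 into
-- the case k = 0 of the condition on consecutive parts.
Free Barred All≤ : ℕ → Family {ℕ × Mark}
Free zero    n xs = ⊥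
Free (suc k) n xs = Repeat (suc k , plain) (suc k) (Free k) n xs ⊎ Barred k n xs
Barred zero       = Nil
Barred (suc k)    = Cons (suc k , overlined) (suc k) (Repeat (suc k , plain) (suc k) (All≤ k))
All≤ k n xs       = Free k n xs ⊎ Barred k n xs

free barred all≤ : ℕ → ℕ → ℕ
free zero    n = 0
free (suc k) n = geometric k (free k) n + barred k n
barred zero    = unit
barred (suc k) = shift (suc k) (geometric k (all≤ k))
all≤ k n       = free k n + barred k n

OverlineOrder : ℕ × Mark → ℕ × Mark → Set
OverlineOrder p q = proj₂ q ≡ overlined → proj₁ q < proj₁ p

IsBarred : ℕ → List (ℕ × Mark) → Set
IsBarred k xs = k ≡ 0 ⊎ OccursOverlined k xs

Chained : ℕ → List (ℕ × Mark) → Set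
Chained k xs = ∀ i → suc i ≤ k → Occurs (suc i) xs → IsBarred i xs → OccursOverlined (suc i) xs

record Admissible (k : ℕ) (xs : List (ℕ × Mark)) : Set where
  field
    sorted  : Decreasing OverlineOrder xs
    bounded : BoundedBy k xs
    chained : Chained k xs

-- What is left of an admissible list with parts at most k + 1 when an overlined k + 1 is removed.
record Layer (k : ℕ) (xs : List (ℕ × Mark)) : Set where
  field
    sorted  : Decreasing OverlineOrder xs
    bounded : BoundedBy (suc k) xs
    plainₖ  : All (λ p → proj₂ p ≡ overlined → proj₁ p ≤ k) xs
    chained : Chained k xs

occurs-bounded : ∀ {A : Set} {k j} {xs : List (ℕ × A)} → BoundedBy k xs → j ∈ map proj₁ xs → j ≤ k
occurs-bounded bound j∈ with ∈-map⁻ proj₁ j∈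
... | _ , p∈ , refl = proj₂ (All.lookup bound p∈)

overlined-occurs : ∀ {k xs} → OccursOverlined k xs → Occurs k xs
overlined-occurs = ∈-map⁺ proj₁

layer-of-admissible : ∀ {k xs} → Admissible k xs → Layer k xs
layer-of-admissible {k} adm = record
  { sorted  = sorted
  ; bounded = bounded-weaken (ℕ.n≤1+n k) bounded
  ; plainₖ  = All.map (λ r _ → proj₂ r) bounded
  ; chained = chained
  } where open Admissible adm

layer-overlined-bounded : ∀ {k j xs} → Layer k xs → OccursOverlined j xs → j ≤ k
layer-overlined-bounded layer j∈ = All.lookup (Layer.plainₖ layer) j∈ refl

-- A layer has no overlined k+1, so the condition linking k to k+1 can hold only vacuously. That is
-- the role of `top`.
admissible-of-layer : ∀ {k xs} → Layer k xs → (Occurs (suc k) xs → ¬ IsBarred k xs) → Admissible (suc k) xs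
admissible-of-layer {k} {xs} layer top = record
  { sorted  = sorted
  ; bounded = bounded
  ; chained = chained′
  }
  where
  open Layer layer
  chained′ : Chained (suc k) xs
  chained′ i si≤sk occurs barred with ℕ.m≤n⇒m<n∨m≡n (s≤s⁻¹ si≤sk)
  ... | inj₁ i<k  = chained i i<k occurs barred
  ... | inj₂ refl = ⊥-elim (top occurs barred)

layer-again : ∀ {k xs} → Layer k xs → Layer k ((suc k , plain) ∷ xs)
layer-again {k} {xs} layer = record
  { sorted  = All.zip (All.map proj₂ bounded , All.map (s≤s ∘_) plainₖ) ∷ sorted
  ; bounded = (s≤s z≤n , ℕ.≤-refl) ∷ bounded
  ; plainₖ  = (λ ()) ∷ plainₖ
  ; chained = chained′
  }
  where
  open Layer layer
  chained′ : Chained k ((suc k , plain) ∷ xs)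
  chained′ i i<k (here refl)    barred         = ⊥-elim (ℕ.1+n≰n i<k)
  chained′ i i<k (there occurs) (inj₁ i≡0)     = there (chained i i<k occurs (inj₁ i≡0))
  chained′ i i<k (there occurs) (inj₂ (there i∈)) = there (chained i i<k occurs (inj₂ i∈))

barred-again : ∀ {k xs} → ¬ IsBarred k xs → ¬ IsBarred k ((suc k , plain) ∷ xs)
barred-again ¬barred (inj₁ k≡0)        = ¬barred (inj₁ k≡0)
barred-again ¬barred (inj₂ (there k∈)) = ¬barred (inj₂ k∈)

-- The new head itself satisfies the condition linking k to k+1, whether or not k is barred. This is
-- why `Barred (suc k)` is built on `All≤ k`.
admissible-overlined : ∀ {k xs} → Layer k xs → Admissible (suc k) ((suc k , overlined) ∷ xs)
admissible-overlined {k} {xs} layer = record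
  { sorted  = All.zip (All.map proj₂ bounded , All.map (s≤s ∘_) plainₖ) ∷ sorted
  ; bounded = (s≤s z≤n , ℕ.≤-refl) ∷ bounded
  ; chained = chained′
  }
  where
  open Layer layer
  chained′ : Chained (suc k) ((suc k , overlined) ∷ xs)
  chained′ i si≤sk (here refl)    barred         = here refl
  chained′ i si≤sk (there occurs) (inj₁ i≡0)     with ℕ.m≤n⇒m<n∨m≡n (s≤s⁻¹ si≤sk)
  ... | inj₁ i<k  = there (chained i i<k occurs (inj₁ i≡0))
  ... | inj₂ refl = here refl
  chained′ i si≤sk (there occurs) (inj₂ (here refl)) = ⊥-elim (ℕ.1+n≰n si≤sk)
  chained′ i si≤sk (there occurs) (inj₂ (there i∈))  with ℕ.m≤n⇒m<n∨m≡n (s≤s⁻¹ si≤sk)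
  ... | inj₁ i<k  = there (chained i i<k occurs (inj₂ i∈))
  ... | inj₂ refl = here refl

layer-repeat : ∀ {k P n xs} → (∀ {n xs} → P n xs → Admissible k xs) →
  Repeat (suc k , plain) (suc k) P n xs → Layer k xs
layer-repeat P⇒ (stop p)  = layer-of-admissible (P⇒ p)
layer-repeat P⇒ (again r) = layer-again (layer-repeat P⇒ r)

barred-repeat : ∀ {k P n xs} → (∀ {n xs} → P n xs → ¬ IsBarred k xs) →
  Repeat (suc k , plain) (suc k) P n xs → ¬ IsBarred k xs
barred-repeat P⇒ (stop p)  = P⇒ p
barred-repeat P⇒ (again r) = barred-again (barred-repeat P⇒ r)

barred-isBarred : ∀ k {n xs} → Barred k n xs → IsBarred k xs
barred-isBarred zero    _        = inj₁ refl
barred-isBarred (suc k) (cons _) = inj₂ (here refl)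

free-admissible   : ∀ k {n xs} → Free k n xs → Admissible k xs
barred-admissible : ∀ k {n xs} → Barred k n xs → Admissible k xs
all-admissible    : ∀ k {n xs} → All≤ k n xs → Admissible k xs
free-unbarred     : ∀ k {n xs} → Free k n xs → ¬ IsBarred k xs

free-admissible (suc k) (inj₁ r) =
  admissible-of-layer (layer-repeat (free-admissible k) r) (λ _ → barred-repeat (free-unbarred k) r)
free-admissible (suc k) (inj₂ b) =
  admissible-of-layer (layer-of-admissible adm)
    (λ sk∈ → ⊥-elim (ℕ.1+n≰n (occurs-bounded (Admissible.bounded adm) sk∈)))
  where adm = barred-admissible k b

barred-admissible zero    (refl , refl) = record { sorted = [] ; bounded = [] ; chained = λ _ () }
barred-admissible (suc k) (cons r)      = admissible-overlined (layer-repeat (all-admissible k) r)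

all-admissible k = [ free-admissible k , barred-admissible k ]′

free-unbarred (suc k) (inj₁ r) (inj₂ sk∈) =
  ℕ.1+n≰n (layer-overlined-bounded (layer-repeat (free-admissible k) r) sk∈)
free-unbarred (suc k) (inj₂ b) (inj₂ sk∈) =
  ℕ.1+n≰n (occurs-bounded (Admissible.bounded (barred-admissible k b)) (overlined-occurs sk∈))

repeat-weight : ∀ {A : Set} {x : ℕ × A} {P n xs} → (∀ {n xs} → P n xs → weight xs ≡ n) →
  Repeat x (proj₁ x) P n xs → weight xs ≡ n
repeat-weight {x = x} P⇒ (stop p)  = P⇒ p
repeat-weight {x = x} P⇒ (again r) = cong (proj₁ x +_) (repeat-weight P⇒ r)

free-weight   : ∀ k {n xs} → Free k n xs → weight xs ≡ n
barred-weight : ∀ k {n xs} → Barred k n xs → weight xs ≡ n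
all-weight    : ∀ k {n xs} → All≤ k n xs → weight xs ≡ n
free-weight (suc k) (inj₁ r)          = repeat-weight (free-weight k) r
free-weight (suc k) (inj₂ b)          = barred-weight k b
barred-weight zero    (refl , refl)   = refl
barred-weight (suc k) (cons r)        = cong (suc k +_) (repeat-weight (all-weight k) r)
all-weight k = [ free-weight k , barred-weight k ]′

repeat-free : ∀ {k n xs} → ¬ IsBarred k xs →
  Repeat (suc k , plain) (suc k) (All≤ k) n xs → Repeat (suc k , plain) (suc k) (Free k) n xs
repeat-free ¬barred (stop (inj₁ f)) = stop f
repeat-free ¬barred (stop (inj₂ b)) = ⊥-elim (¬barred (barred-isBarred _ b))
repeat-free ¬barred (again r)       = again (repeat-free (¬barred ∘ Sum.map id there) r)

-- The overlined part demanded for a size at most k cannot be the removed head, whose size is k+1.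
chained-tail : ∀ {k m xs} → Chained k ((suc k , m) ∷ xs) → Chained k xs
chained-tail chained i i<k occurs barred with chained i i<k (there occurs) (Sum.map id there barred)
... | here refl = ⊥-elim (ℕ.1+n≰n i<k)
... | there i∈  = i∈

module _ {k} (complete : ∀ {xs} → Admissible k xs → All≤ k (weight xs) xs) where

  -- Induction on the list: a head of size k+1 must be plain and is split off. Once the head is at
  -- most k, sortedness bounds the rest and the induction hypothesis `complete` applies.
  layer-complete : ∀ {xs} → Layer k xs → Repeat (suc k , plain) (suc k) (All≤ k) (weight xs) xs
  layer-complete {[]} layer = stop (complete record
    { sorted = [] ; bounded = [] ; chained = λ _ _ () })
  layer-complete {(j , m) ∷ xs} layer with j ≤? k
  ... | yes j≤k = stop (complete record
    { sorted  = Layer.sorted layer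
    ; bounded = bounded-of-small-head (Layer.sorted layer) (bounded-positive (Layer.bounded layer)) j≤k
    ; chained = Layer.chained layer
    })
  layer-complete {(j , overlined) ∷ xs} layer | no j≰k = ⊥-elim (j≰k (All.head (Layer.plainₖ layer) refl))
  layer-complete {(j , plain) ∷ xs}     layer | no j≰k
    with ℕ.≤-antisym (proj₂ (All.head (Layer.bounded layer))) (ℕ.≰⇒> j≰k)
  ... | refl = again (layer-complete record
    { sorted  = AllPairs.tail (Layer.sorted layer)
    ; bounded = All.tail (Layer.bounded layer)
    ; plainₖ  = All.tail (Layer.plainₖ layer)
    ; chained = chained-tail (Layer.chained layer)
    })

  unbarred-complete : ∀ {xs} → Layer k xs → (Occurs (suc k) xs → ¬ IsBarred k xs) → Free (suc k) (weight xs) xs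
  unbarred-complete {xs} layer top with weight xs | layer-complete layer
  ... | _ | stop (inj₁ f) = inj₁ (stop f)
  ... | _ | stop (inj₂ b) = inj₂ b
  -- Now k+1 occurs, so `top` excludes `Barred k` underneath the copies.
  ... | _ | again r       = inj₁ (repeat-free (top (here refl)) (again r))

  admissible-layer : ∀ {xs} → Admissible (suc k) xs → All (λ p → proj₂ p ≡ overlined → proj₁ p ≤ k) xs →
    Free (suc k) (weight xs) xs
  admissible-layer {xs} adm plainₖ = unbarred-complete
    record
      { sorted  = sorted
      ; bounded = bounded
      ; plainₖ  = plainₖ
      ; chained = λ i i<k → chained i (ℕ.m≤n⇒m≤1+n i<k)
      }
    -- If k+1 occurred above a barred k, the chain condition would force an overlined k+1, against
    -- `plainₖ`.
    (λ sk∈ barred → ℕ.1+n≰n (All.lookup plainₖ (chained k ℕ.≤-refl sk∈ barred) refl))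
    where open Admissible adm

  tail-overlined-≤ : ∀ {x xs} → Admissible (suc k) (x ∷ xs) → All (λ p → proj₂ p ≡ overlined → proj₁ p ≤ k) xs
  tail-overlined-≤ adm = All.map (λ r ov → s≤s⁻¹ (ℕ.≤-trans (proj₂ r ov) x≤sk)) (AllPairs.head sorted)
    where
    open Admissible adm
    x≤sk = proj₂ (All.head bounded)

  admissible-step : ∀ {xs} → Admissible (suc k) xs → All≤ (suc k) (weight xs) xs
  admissible-step {[]} adm = inj₁ (admissible-layer adm [])
  admissible-step {(j , plain) ∷ xs} adm = inj₁ (admissible-layer adm ((λ ()) ∷ tail-overlined-≤ adm))
  admissible-step {(j , overlined) ∷ xs} adm with j ≤? k
  ... | yes j≤k = inj₁ (admissible-layer adm ((λ _ → j≤k) ∷ tail-overlined-≤ adm))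
  ... | no  j≰k with ℕ.≤-antisym (proj₂ (All.head (Admissible.bounded adm))) (ℕ.≰⇒> j≰k)
  ...   | refl = inj₂ (cons (layer-complete record
    { sorted  = AllPairs.tail sorted
    ; bounded = All.tail bounded
    ; plainₖ  = tail-overlined-≤ adm
    ; chained = chained-tail {m = overlined} (λ i i<k → chained i (ℕ.m≤n⇒m≤1+n i<k))
    }))
    where open Admissible adm

all-complete : ∀ k {xs} → Admissible k xs → All≤ k (weight xs) xs
all-complete zero {[]}     adm = inj₂ (refl , refl)
all-complete zero {x ∷ xs} adm with All.head (Admissible.bounded adm)
... | 0<x , x≤0 = ⊥-elim (ℕ.1+n≰n (ℕ.≤-trans 0<x x≤0))
all-complete (suc k) = admissible-step (all-complete k)

all-disjoint : ∀ k {n xs} → Free k n xs → ¬ Barred k n xs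
all-disjoint k f b = free-unbarred k f (barred-isBarred k b)

count-free   : ∀ k → Counts (Free k) (free k)
count-barred : ∀ k → Counts (Barred k) (barred k)
count-all    : ∀ k → Counts (All≤ k) (all≤ k)
count-free zero    n = cardinality-∅ (λ _ ())
count-free (suc k) n = cardinality-⊎
  (λ _ r b → barred-repeat (free-unbarred k) r (barred-isBarred k b))
  (count-Repeat (λ n xs f → bounded-head-absent (Admissible.bounded (free-admissible k f))) (count-free k) k n)
  (count-barred k n)
count-barred zero    = count-Nil
count-barred (suc k) = count-Cons
  (count-Repeat (λ n xs p → bounded-head-absent (Admissible.bounded (all-admissible k p))) (count-all k) k) (suc k)
count-all k n = cardinality-⊎ (λ _ → all-disjoint k) (count-free k n) (count-barred k n)

OverlineOrder-trans : ∀ p q r → proj₁ q ≤ proj₁ p → OverlineOrder p q →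
  proj₁ r ≤ proj₁ q → OverlineOrder q r → OverlineOrder p r
OverlineOrder-trans _ _ _ q≤p _ _ Rqr ov = ℕ.<-≤-trans (Rqr ov) q≤p

all⇔admissibleOverpartition : ∀ {n k} → n ≤ k → ∀ xs → All≤ k n xs ⇔ IsAdmissibleOverpartition n xs
all⇔admissibleOverpartition {n} {k} n≤k xs = mk⇔ to from
  where
  to : All≤ k n xs → IsAdmissibleOverpartition n xs
  to p with all-weight k p
  ... | refl = record
    { overpartition = record
      { partition     = isPartition sorted bounded
      ; overlineFirst = Linked.map proj₂ (Linked.AllPairs⇒Linked sorted)
      }
    ; one         = λ 1∈ → chained 0 (occurs-bounded bounded 1∈) 1∈ (inj₁ refl)
    ; consecutive = λ i _ si∈ ov → chained i (occurs-bounded bounded si∈) si∈ (inj₂ ov)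
    }
    where open Admissible (all-admissible k p)
  from : IsAdmissibleOverpartition n xs → All≤ k n xs
  from p = subst (λ n → All≤ k n xs) total (all-complete k record
    { sorted  = decreasing OverlineOrder-trans nonIncreasing overlineFirst
    ; bounded = partition-bounded n≤k partition
    ; chained = chained
    })
    where
    open IsAdmissibleOverpartition p
    open IsOverpartition overpartition
    open IsPartition partition
    chained : Chained k xs
    chained zero    _ si∈ _         = one si∈
    chained (suc i) _ si∈ (inj₂ ov) = consecutive (suc i) (s≤s z≤n) si∈ ov

-- Two-colour partitions

-- The decision is an argument because the residue of a variable `k` does not reduce. Properties are
-- proved for every decision by matching on it.
GreenIf : ∀ {ℓ} {X : Set ℓ} → Dec X → ℕ → Family {ℕ × Colour} → Family {ℕ × Colour}
GreenIf (yes _) k P = Repeat (suc k , green) (suc k) P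
GreenIf (no _)  k P = P

greenIf : ∀ {ℓ} {X : Set ℓ} → Dec X → ℕ → (ℕ → ℕ) → ℕ → ℕ
greenIf (yes _) k f = geometric k f
greenIf (no _)  k f = f

green? : ∀ k → Dec (k % 3 ≡ 2)
green? k = k % 3 ≟ 2

-- Reds are added outside the greens of the same size, which yields exactly the canonical order of
-- `redBeforeGreen`.
Coloured : ℕ → Family {ℕ × Colour}
Coloured zero    = Nil
Coloured (suc k) = Repeat (suc k , red) (suc k) (GreenIf (green? (suc k)) k (Coloured k))

coloured : ℕ → ℕ → ℕ
coloured zero    = unit
coloured (suc k) = geometric k (greenIf (green? (suc k)) k (coloured k))

ColourOrder : ℕ × Colour → ℕ × Colour → Set
ColourOrder p q = proj₁ p ≡ proj₁ q → proj₂ p ≡ green → proj₂ q ≡ green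

Green2Mod3 : ℕ × Colour → Set
Green2Mod3 p = proj₂ p ≡ green → proj₁ p % 3 ≡ 2

record TwoColour (k : ℕ) (xs : List (ℕ × Colour)) : Set where
  field
    sorted     : Decreasing ColourOrder xs
    bounded    : BoundedBy k xs
    green2Mod3 : All Green2Mod3 xs

-- What is left of a two-colour list with parts at most k + 1 when the red parts k + 1 are removed.
record GreenLayer (k : ℕ) (xs : List (ℕ × Colour)) : Set where
  field
    twoColour : TwoColour (suc k) xs
    redₖ      : All (λ p → proj₂ p ≡ red → proj₁ p ≤ k) xs
  open TwoColour twoColour public

greenLayer-of-twoColour : ∀ {k xs} → TwoColour k xs → GreenLayer k xs
greenLayer-of-twoColour {k} two = record
  { twoColour = record
    { sorted     = sorted
    ; bounded    = bounded-weaken (ℕ.n≤1+n k) bounded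
    ; green2Mod3 = green2Mod3
    }
  ; redₖ = All.map (λ r _ → proj₂ r) bounded
  } where open TwoColour two

green-again : ∀ {k xs} → suc k % 3 ≡ 2 → GreenLayer k xs → GreenLayer k ((suc k , green) ∷ xs)
green-again {k} {xs} 2mod3 layer = record
  { twoColour = record
    { sorted     = All.zip (All.map proj₂ bounded , All.map before redₖ) ∷ sorted
    ; bounded    = (s≤s z≤n , ℕ.≤-refl) ∷ bounded
    ; green2Mod3 = (λ _ → 2mod3) ∷ green2Mod3
    }
  ; redₖ = (λ ()) ∷ redₖ
  }
  where
  open GreenLayer layer
  before : ∀ {p} → (proj₂ p ≡ red → proj₁ p ≤ k) → ColourOrder (suc k , green) p
  before {_ , green} _  _    _ = refl
  before {_ , red}   ≤k refl _ = ⊥-elim (ℕ.1+n≰n (≤k refl))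

red-again : ∀ {k xs} → TwoColour (suc k) xs → TwoColour (suc k) ((suc k , red) ∷ xs)
red-again two = record
  { sorted     = All.map (λ r → proj₂ r , (λ _ ())) bounded ∷ sorted
  ; bounded    = (s≤s z≤n , ℕ.≤-refl) ∷ bounded
  ; green2Mod3 = (λ ()) ∷ green2Mod3
  } where open TwoColour two

coloured-twoColour : ∀ k {n xs} → Coloured k n xs → TwoColour k xs
coloured-twoColour zero    (refl , refl) = record { sorted = [] ; bounded = [] ; green2Mod3 = [] }
coloured-twoColour (suc k) = reds
  where
  greens : ∀ {n xs} → suc k % 3 ≡ 2 → Repeat (suc k , green) (suc k) (Coloured k) n xs → GreenLayer k xs
  greens 2mod3 (stop p)  = greenLayer-of-twoColour (coloured-twoColour k p)
  greens 2mod3 (again r) = green-again 2mod3 (greens 2mod3 r)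
  greenIf-layer : ∀ {n xs} (d : Dec (suc k % 3 ≡ 2)) → GreenIf d k (Coloured k) n xs → GreenLayer k xs
  greenIf-layer (yes 2mod3) = greens 2mod3
  greenIf-layer (no _)      = greenLayer-of-twoColour ∘ coloured-twoColour k
  reds : ∀ {n xs} → Coloured (suc k) n xs → TwoColour (suc k) xs
  reds (stop p)  = GreenLayer.twoColour (greenIf-layer (green? (suc k)) p)
  reds (again r) = red-again (reds r)

greenIf-weight : ∀ {X : Set} (d : Dec X) {k P n xs} → (∀ {n xs} → P n xs → weight xs ≡ n) →
  GreenIf d k P n xs → weight xs ≡ n
greenIf-weight (yes _) P⇒ = repeat-weight P⇒
greenIf-weight (no _)  P⇒ = P⇒

coloured-weight : ∀ k {n xs} → Coloured k n xs → weight xs ≡ n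
coloured-weight zero    (refl , refl) = refl
coloured-weight (suc k) = repeat-weight (greenIf-weight (green? (suc k)) (coloured-weight k))

twoColour-tail : ∀ {k x xs} → TwoColour k (x ∷ xs) → TwoColour k xs
twoColour-tail two = record
  { sorted     = AllPairs.tail sorted
  ; bounded    = All.tail bounded
  ; green2Mod3 = All.tail green2Mod3
  } where open TwoColour two

twoColour-lower : ∀ {k x xs} → TwoColour (suc k) (x ∷ xs) → proj₁ x ≤ k → TwoColour k (x ∷ xs)
twoColour-lower two x≤k = record
  { sorted     = sorted
  ; bounded    = bounded-of-small-head sorted (bounded-positive bounded) x≤k
  ; green2Mod3 = green2Mod3
  } where open TwoColour two

twoColour-[] : ∀ {k} → TwoColour k []
twoColour-[] = record { sorted = [] ; bounded = [] ; green2Mod3 = [] }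

module _ {k} (complete : ∀ {xs} → TwoColour k xs → Coloured k (weight xs) xs) where

  greens-complete : ∀ {xs} (d : Dec (suc k % 3 ≡ 2)) → GreenLayer k xs → GreenIf d k (Coloured k) (weight xs) xs
  greens-complete {[]} (yes _) layer = stop (complete twoColour-[])
  greens-complete {[]} (no _)  layer = complete twoColour-[]
  greens-complete {(j , c) ∷ xs} d layer with j ≤? k
  greens-complete {(j , c) ∷ xs} (yes _) layer | yes j≤k = stop (complete (twoColour-lower (GreenLayer.twoColour layer) j≤k))
  greens-complete {(j , c) ∷ xs} (no _)  layer | yes j≤k = complete (twoColour-lower (GreenLayer.twoColour layer) j≤k)
  greens-complete {(j , red) ∷ xs} d layer | no j≰k = ⊥-elim (j≰k (All.head (GreenLayer.redₖ layer) refl))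
  greens-complete {(j , green) ∷ xs} d layer | no j≰k
    with ℕ.≤-antisym (proj₂ (All.head (GreenLayer.bounded layer))) (ℕ.≰⇒> j≰k)
  greens-complete {(j , green) ∷ xs} (no ¬2mod3) layer | no j≰k | refl =
    ⊥-elim (¬2mod3 (All.head (GreenLayer.green2Mod3 layer) refl))
  greens-complete {(j , green) ∷ xs} (yes 2mod3) layer | no j≰k | refl =
    again (greens-complete (yes 2mod3) record
      { twoColour = twoColour-tail (GreenLayer.twoColour layer)
      ; redₖ      = All.tail (GreenLayer.redₖ layer)
      })

  reds-complete : ∀ {xs} → TwoColour (suc k) xs → Coloured (suc k) (weight xs) xs
  reds-complete {[]} two = stop (greens-complete (green? (suc k)) record { twoColour = twoColour-[] ; redₖ = [] })
  reds-complete {(j , c) ∷ xs} two with j ≤? k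
  ... | yes j≤k = stop (greens-complete (green? (suc k)) (greenLayer-of-twoColour (twoColour-lower two j≤k)))
  ... | no j≰k with ℕ.≤-antisym (proj₂ (All.head (TwoColour.bounded two))) (ℕ.≰⇒> j≰k)
  reds-complete {(_ , red) ∷ xs}   two | no _ | refl = again (reds-complete (twoColour-tail two))
  reds-complete {(_ , green) ∷ xs} two | no _ | refl = stop (greens-complete (green? (suc k)) record
    { twoColour = two
    ; redₖ      = (λ ()) ∷ All.map below (AllPairs.head (TwoColour.sorted two))
    })
    where
    below : ∀ {q} → proj₁ q ≤ suc k × ColourOrder (suc k , green) q → proj₂ q ≡ red → proj₁ q ≤ k
    below {_ , red} (q≤ , order) refl with ℕ.m≤n⇒m<n∨m≡n q≤
    ... | inj₁ q<sk = s≤s⁻¹ q<sk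
    ... | inj₂ refl with order refl refl
    ...   | ()

coloured-complete : ∀ k {xs} → TwoColour k xs → Coloured k (weight xs) xs
coloured-complete zero {[]}     two = refl , refl
coloured-complete zero {x ∷ xs} two with All.head (TwoColour.bounded two)
... | 0<x , x≤0 = ⊥-elim (ℕ.1+n≰n (ℕ.≤-trans 0<x x≤0))
coloured-complete (suc k) = reds-complete (coloured-complete k)

coloured-fresh : ∀ k {c} n xs → ¬ Coloured k n ((suc k , c) ∷ xs)
coloured-fresh k n xs p = bounded-head-absent (TwoColour.bounded (coloured-twoColour k p))

greenIf-fresh : ∀ {X : Set} (d : Dec X) k n xs → ¬ GreenIf d k (Coloured k) n ((suc k , red) ∷ xs)
greenIf-fresh (yes _) k n xs (stop p) = coloured-fresh k n xs p
greenIf-fresh (no _)  k n xs p        = coloured-fresh k n xs p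

count-greenIf : ∀ {X : Set} (d : Dec X) k {f} → Counts (Coloured k) f → Counts (GreenIf d k (Coloured k)) (greenIf d k f)
count-greenIf (yes _) k count = count-Repeat (coloured-fresh k) count k
count-greenIf (no _)  k count = count

count-coloured : ∀ k → Counts (Coloured k) (coloured k)
count-coloured zero    = count-Nil
count-coloured (suc k) = count-Repeat (greenIf-fresh d k) (count-greenIf d k (count-coloured k)) k
  where d = green? (suc k)

ColourOrder-trans : ∀ p q r → proj₁ q ≤ proj₁ p → ColourOrder p q →
  proj₁ r ≤ proj₁ q → ColourOrder q r → ColourOrder p r
ColourOrder-trans p q r q≤p Rpq r≤q Rqr refl p-green with ℕ.≤-antisym q≤p r≤q
... | refl = Rqr refl (Rpq refl p-green)

coloured⇔twoColourPartition : ∀ {n k} → n ≤ k → ∀ xs → Coloured k n xs ⇔ IsTwoColourPartitionGreen2Mod3 n xs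
coloured⇔twoColourPartition {n} {k} n≤k xs = mk⇔ to from
  where
  to : Coloured k n xs → IsTwoColourPartitionGreen2Mod3 n xs
  to p with coloured-weight k p
  ... | refl = record
    { twoColour = record
      { partition      = isPartition sorted bounded
      ; redBeforeGreen = Linked.map proj₂ (Linked.AllPairs⇒Linked sorted)
      }
    ; green2Mod3 = green2Mod3
    }
    where open TwoColour (coloured-twoColour k p)
  from : IsTwoColourPartitionGreen2Mod3 n xs → Coloured k n xs
  from p = subst (λ n → Coloured k n xs) total (coloured-complete k record
    { sorted     = decreasing ColourOrder-trans nonIncreasing redBeforeGreen
    ; bounded    = partition-bounded n≤k partition
    ; green2Mod3 = green2Mod3
    })
    where
    open IsTwoColourPartitionGreen2Mod3 p
    open IsTwoColourPartition twoColour
    open IsPartition partition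

-- Comparison of the two counts

greenIf-yes : ∀ {X : Set} (d : Dec X) → X → ∀ k f → greenIf d k f ≡ geometric k f
greenIf-yes (yes _) x k f = refl
greenIf-yes (no ¬x) x k f = ⊥-elim (¬x x)

greenIf-no : ∀ {X : Set} (d : Dec X) → ¬ X → ∀ k f → greenIf d k f ≡ f
greenIf-no (yes x) ¬x k f = ⊥-elim (¬x x)
greenIf-no (no _)  ¬x k f = refl

residue : ∀ r N → (r + N * 3) % 3 ≡ r % 3
residue r N = [m+kn]%n≡m%n r N 3

-- Modulo q^(n+1) both generating functions equal `h K * g N`, with N a third of K. The claim is the
-- equality of their coefficients of q^n.
all≤≡coloured : ∀ n → let K = (suc n + suc n) * 3 in all≤ K n ≡ coloured K n
all≤≡coloured n = series-injective {all≤ K} {coloured K} (R.trans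
    (Q.all≈h*g (λ k → series (free k)) (λ k → series (barred k))
      (λ k → series (geometric k (free k))) (λ k → series (geometric k (all≤ k)))
      (pointwise λ _ → refl) series-unit
      (λ k → series-geometric k (free k))
      (λ k → series-geometric k (all≤ k))
      (λ k → R.refl)
      (λ k → series-shift (suc k) (geometric k (all≤ k)))
      J ℕ.≤-refl N K-large (ℕ.n≤1+n N))
    (R.sym (Q.coloured≈h*g (λ k → series (coloured k)) (λ N → series (geometric (suc (N * 3)) (coloured (suc (N * 3)))))
      series-unit (λ N → factor-no N 0 λ ()) (λ N → factor-yes N)
      (λ N → series-geometric (suc (N * 3)) (coloured (suc (N * 3))))
      (λ N → factor-no N 2 λ ()) N)))
  where
  open TruncatedPowerSeries n
  open import Algebra.Properties.CommutativeSemiring.Exp R.commutativeSemiring using (_^_)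
  -- With M = n+1, the choice J = M kills the boundary terms. N = 2J gives M + J ≤ N + 1, and K = 6J
  -- exceeds M + 3J = 4J.
  J = suc n
  N = J + J
  K = N * 3
  inv : ℕ → Series
  inv k = series (geometric k unit)
  inv-inverse : ∀ k → (R.1# R.- q ^ suc k) R.* inv k ≈ R.1#
  inv-inverse k = R.trans (series-geometric k unit) series-unit
  module Q = QSeries.Truncated commutativeRing constant-homomorphism q (suc n) q^[1+N]≈0 inv inv-inverse

  K-large : J + J * 3 ≤ suc (suc K)
  K-large = ℕ.m≤n⇒m≤1+n (ℕ.m≤n⇒m≤1+n (ℕ.≤-trans (ℕ.+-monoˡ-≤ (J * 3) (ℕ.m≤m*n J 3))
    (ℕ.≤-reflexive (≡.sym (ℕ.*-distribʳ-+ 3 J J)))))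

  factor : ∀ k {f} → greenIf (green? (suc k)) k (coloured k) ≡ f →
    (R.1# R.- q ^ suc k) R.* series (coloured (suc k)) ≈ series f
  factor k refl = series-geometric k _

  factor-no : ∀ N r → ¬ suc r % 3 ≡ 2 →
    (R.1# R.- q ^ suc (r + N * 3)) R.* series (coloured (suc (r + N * 3))) ≈ series (coloured (r + N * 3))
  factor-no N r r≢ = factor (r + N * 3)
    (greenIf-no (green? (suc (r + N * 3))) (λ eq → r≢ (≡.trans (≡.sym (residue (suc r) N)) eq)) _ _)

  factor-yes : ∀ N → let k = suc (N * 3) in
    (R.1# R.- q ^ suc k) R.* series (coloured (suc k)) ≈ series (geometric k (coloured k))
  factor-yes N = factor (suc (N * 3)) (greenIf-yes (green? (2 + N * 3)) (residue 2 N) _ _)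

theorem1p5 : ∀ (n : ℕ) → ∃[ N ] (HasCardinality (IsAdmissibleOverpartition n) N × HasCardinality (IsTwoColourPartitionGreen2Mod3 n) N)
theorem1p5 n =
  all≤ K n ,
  cardinality-resp (all⇔admissibleOverpartition n≤K) (count-all K n) ,
  subst (HasCardinality _) (≡.sym (all≤≡coloured n))
    (cardinality-resp (coloured⇔twoColourPartition n≤K) (count-coloured K n))
  where
  K = (suc n + suc n) * 3
  n≤K : n ≤ K
  n≤K = ℕ.≤-trans (ℕ.n≤1+n n) (ℕ.≤-trans (ℕ.m≤m+n (suc n) (suc n)) (ℕ.m≤m*n (suc n + suc n) 3))
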